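{- For any finite set $D$ and function $f\colon D\times D\to D$ there is an algorithm for the $f$-Query problem with running time $\widetilde{\mathcal{O}}\left(|D|^{\omega\cdot n/2}\cdot\mathrm{polylog}(M)\right)$.
   Context: For $\mathbf{u},\mathbf{w}\in D^n$ write $\mathbf{u}\oplus_f\mathbf{w}=(f(\mathbf{u}_1,\mathbf{w}_1),\ldots,f(\mathbf{u}_n,\mathbf{w}_n))$. For $g,h\colon D^n\to\mathbb{Z}$ the $f$-convolution $g\circledast_f h\colon D^n\to\mathbb{Z}$ is $$(g\circledast_f h)(\mathbf{v})=\sum_{\mathbf{v}_g,\mathbf{v}_h\in D^n\text{ s.t. }\mathbf{v}=\mathbf{v}_g\oplus_f\mathbf{v}_h} g(\mathbf{v}_g)\cdot h(\mathbf{v}_h)\qquad(\mathbf{v}\in D^n).$$ $f$-Query problem: $D$ and $f$ are fixed (of constant size). The input consists of functions $g,h\colon D^n\to\{ -M,\ldots,M\}$ (given by listing all their values), where $M$ is the maximum absolute value of the integers in the input, and a single vector $\mathbf{v}\in D^n$; the task is to compute the integer $(g\circledast_f h)(\mathbf{v})$. Here $\omega$ is the matrix multiplication exponent: two $m\times m$ integer matrices with entries in $\{ -M,\ldots,M\}$ can be multiplied in time $\widetilde{\mathcal{O}}(m^\omega\cdot\mathrm{polylog}(M))$ (currently $\omega\in[2,2.372)$). The notation $\widetilde{\mathcal{O}}(\cdot)$ hides polylogarithmic factors. -}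

module Defs where

open import Data.Bool using (if_then_else_; _∧_)
open import Data.Fin as Fin using (Fin; toℕ)
import Data.Fin.Properties as Fin
open import Data.Integer as ℤ using (ℤ; +_; +0; +[1+_]; -[1+_]; 0ℤ; ∣_∣)
open import Data.List
  using (List; []; _∷_; map; foldr; filter; length; lookup; allFin;
         cartesianProduct; cartesianProductWith)
open import Data.Nat
  using (ℕ; zero; suc; _+_; _*_; _^_; _≤_; NonZero)
import Data.Nat as ℕ
open import Data.Nat.Logarithm using (⌊log₂_⌋)
open import Data.Product using (Σ-syntax; ∃; ∃-syntax; _×_; _,_)
open import Data.Rational as ℚ using (ℚ)
open import Data.Sum using (_⊎_)
open import Data.Vec as Vec using (Vec; []; _∷_)
import Data.Vec.Properties as Vec
open import Function.Bundles using (_↔_; Inverse)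
open import Function.Properties.Inverse using (↔⇒↣)
open import Relation.Binary.Definitions using (DecidableEquality)
open import Relation.Binary.PropositionalEquality using (_≡_)
open import Relation.Nullary using (¬_; does)
open import Relation.Nullary.Decidable using (via-injection)

-- Dedekind cuts.

record ℝ : Set₁ where
  field
    lower upper     : ℚ → Set
    lower-inhabited : ∃ lower
    upper-inhabited : ∃ upper
    lower-closed    : ∀ {q r} → q ℚ.< r → lower r → lower q
    upper-closed    : ∀ {q r} → q ℚ.< r → upper q → upper r
    lower-open      : ∀ {q} → lower q → ∃[ r ] q ℚ.< r × lower r
    upper-open      : ∀ {r} → upper r → ∃[ q ] q ℚ.< r × upper q
    disjoint        : ∀ {q} → ¬ (lower q × upper q)
    located         : ∀ {q r} → q ℚ.< r → lower q ⊎ upper r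

open ℝ public

infix 4 _≤ʳ_

_≤ʳ_ : ℚ → ℝ → Set
q ≤ʳ ω = ∀ {r} → upper ω r → q ℚ.< r

-- t ≤ K · b ^ (ω · i / j), for a real ω ≥ 0 and natural numbers t, K, b, i, j
-- with b, j ≥ 1 (or b = i = 0, where the power is 1).  As x ↦ b ^ x is
-- continuous and monotone, the inequality holds iff  t ≤ K · b ^ ((p / q) · i / j)
-- for every rational p / q > ω; raising this to the power q j clears all roots.

infix 4 _≤_·_^⟨_·_/_⟩

_≤_·_^⟨_·_/_⟩ : ℕ → ℕ → ℕ → ℝ → ℕ → (j : ℕ) .{{_ : NonZero j}} → Set
t ≤ K · b ^⟨ ω · i / j ⟩ =
  ∀ (p q : ℕ) .{{_ : NonZero q}} → upper ω (+ p ℚ./ q) →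
  t ^ (q * j) ≤ K ^ (q * j) * b ^ (p * i)

-- The number of binary digits of x, except that bits 0 = 1.

bits : ℕ → ℕ
bits x = suc ⌊log₂ x ⌋

-- The model of computation is the random access machine with integer registers
-- and logarithmic cost: an operation is charged the lengths of its operands,
-- addresses included.  Programs are structured, and the memory is divided into
-- arrays, of which a given program names only finitely many; a scalar variable
-- is an array used at index 0 only.

data Op : Set where
  add sub mul div : Op

⟦_⟧ : Op → ℤ → ℤ → ℤ
⟦ add ⟧ x y          = x ℤ.+ y
⟦ sub ⟧ x y          = x ℤ.- y
⟦ mul ⟧ x y          = x ℤ.* y
⟦ div ⟧ x +0           = 0ℤ
⟦ div ⟧ x y@(+[1+ _ ]) = x ℤ./ y
⟦ div ⟧ x y@(-[1+ _ ]) = x ℤ./ y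

infix 25 _[_]
infix 20 _[_]≔_
infixr 15 _⨾_

data Exp : Set where
  lit  : ℤ → Exp
  _[_] : ℕ → Exp → Exp
  op   : Op → Exp → Exp → Exp

-- The tests of the conditional and of the loop are  0 < e.

data Cmd : Set where
  skip    : Cmd
  _[_]≔_  : ℕ → Exp → Exp → Cmd
  _⨾_     : Cmd → Cmd → Cmd
  if0<    : Exp → Cmd → Cmd → Cmd
  while0< : Exp → Cmd → Cmd

State : Set
State = ℕ → ℤ → ℤ

_[_,_↦_] : State → ℕ → ℤ → ℤ → State
(s [ a , i ↦ x ]) b j =
  if does (a ℕ.≟ b) ∧ does (i ℤ.≟ j) then x else s b j

len : ℤ → ℕ
len x = bits ∣ x ∣

eval : State → Exp → ℤ
eval s (lit x)      = x
eval s (a [ e ])    = s a (eval s e)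
eval s (op o e₁ e₂) = ⟦ o ⟧ (eval s e₁) (eval s e₂)

cost : State → Exp → ℕ
cost s (lit x)      = len x
cost s (a [ e ])    = cost s e + (len (eval s e) + len (s a (eval s e)))
cost s (op o e₁ e₂) = cost s e₁ + cost s e₂ + (len (eval s e₁) + len (eval s e₂))

testCost : State → Exp → ℕ
testCost s e = cost s e + len (eval s e)

writeCost : State → Exp → Exp → ℕ
writeCost s i e = cost s i + cost s e + (len (eval s i) + len (eval s e))

-- ⟨ c , s ⟩⇓⟨ s′ , t ⟩ : started in s, the program c halts in s′ after time t.

data ⟨_,_⟩⇓⟨_,_⟩ : Cmd → State → State → ℕ → Set where

  ⇓skip : ∀ {s} → ⟨ skip , s ⟩⇓⟨ s , 1 ⟩

  ⇓write : ∀ {a i e s} →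
    ⟨ a [ i ]≔ e , s ⟩⇓⟨ s [ a , eval s i ↦ eval s e ] , writeCost s i e ⟩

  ⇓seq : ∀ {c₁ c₂ s s′ s″ t₁ t₂} →
    ⟨ c₁ , s ⟩⇓⟨ s′ , t₁ ⟩ → ⟨ c₂ , s′ ⟩⇓⟨ s″ , t₂ ⟩ →
    ⟨ c₁ ⨾ c₂ , s ⟩⇓⟨ s″ , t₁ + t₂ ⟩

  ⇓then : ∀ {e c₁ c₂ s s′ t} → 0ℤ ℤ.< eval s e →
    ⟨ c₁ , s ⟩⇓⟨ s′ , t ⟩ →
    ⟨ if0< e c₁ c₂ , s ⟩⇓⟨ s′ , testCost s e + t ⟩

  ⇓else : ∀ {e c₁ c₂ s s′ t} → eval s e ℤ.≤ 0ℤ →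
    ⟨ c₂ , s ⟩⇓⟨ s′ , t ⟩ →
    ⟨ if0< e c₁ c₂ , s ⟩⇓⟨ s′ , testCost s e + t ⟩

  ⇓loop : ∀ {e c s s′ s″ t₁ t₂} → 0ℤ ℤ.< eval s e →
    ⟨ c , s ⟩⇓⟨ s′ , t₁ ⟩ → ⟨ while0< e c , s′ ⟩⇓⟨ s″ , t₂ ⟩ →
    ⟨ while0< e c , s ⟩⇓⟨ s″ , testCost s e + t₁ + t₂ ⟩

  ⇓exit : ∀ {e c s} → eval s e ℤ.≤ 0ℤ →
    ⟨ while0< e c , s ⟩⇓⟨ s , testCost s e ⟩

-- The a-th input list is stored in array a from index 0 on; every other cell of
-- the memory is initially 0.  The output list is read off array 0 from index 0
-- on.

nth : {A : Set} → A → List A → ℕ → A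
nth z []       _       = z
nth z (x ∷ xs) zero    = x
nth z (x ∷ xs) (suc i) = nth z xs i

initial : List (List ℤ) → State
initial xss a (+ i)    = nth 0ℤ (nth [] xss a) i
initial xss a -[1+ _ ] = 0ℤ

Outputs : State → List ℤ → Set
Outputs s ys = ∀ (i : Fin (length ys)) → s 0 (+ toℕ i) ≡ lookup ys i

-- On input xss, c halts with output ys, after a time satisfying B.

Computes : Cmd → List (List ℤ) → List ℤ → (ℕ → Set) → Set
Computes c xss ys B =
  Σ[ s ∈ State ] Σ[ t ∈ ℕ ]
    ⟨ c , initial xss ⟩⇓⟨ s , t ⟩ × Outputs s ys × B t

sumℤ : List ℤ → ℤ
sumℤ = foldr ℤ._+_ 0ℤ

Matrix : ℕ → Set
Matrix m = Fin m → Fin m → ℤ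

_⊗_ : ∀ {m} → Matrix m → Matrix m → Matrix m
_⊗_ {m} A B i j = sumℤ (map (λ k → A i k ℤ.* B k j) (allFin m))

rowMajor : ∀ {m} → Matrix m → List ℤ
rowMajor {m} A = cartesianProductWith A (allFin m) (allFin m)

-- ω is an admissible exponent of matrix multiplication: ω ≥ 2, and one program
-- multiplies m × m integer matrices with entries in {-M, …, M} in time
-- O(m ^ ω · (log m) ^ k · (log M) ^ k).  Minimality of ω is not required.

record IsMatMulExponent (ω : ℝ) : Set where
  field
    2≤ω      : + 2 ℚ./ 1 ≤ʳ ω
    program  : Cmd
    C k      : ℕ
    computes : ∀ (m : ℕ) .{{_ : NonZero m}} (A B : Matrix m) (M : ℕ) →
      (∀ i j → ∣ A i j ∣ ≤ M) → (∀ i j → ∣ B i j ∣ ≤ M) →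
      Computes program
        ((+ m ∷ []) ∷ rowMajor A ∷ rowMajor B ∷ [])
        (rowMajor (A ⊗ B))
        (λ t → t ≤ C * bits m ^ k * bits M ^ k · m ^⟨ ω · 1 / 1 ⟩)

module FQuery {D : Set} {d : ℕ} (enum : D ↔ Fin d) (f : D → D → D) where

  open Inverse enum using (to; from)

  _≟ᴰ_ : DecidableEquality D
  _≟ᴰ_ = via-injection (↔⇒↣ enum) Fin._≟_

  _⊕_ : ∀ {n} → Vec D n → Vec D n → Vec D n
  _⊕_ = Vec.zipWith f

  -- All vectors of D ^ n, each once, in lexicographic order.
  vectors : ∀ n → List (Vec D n)
  vectors zero    = [] ∷ []
  vectors (suc n) = cartesianProductWith _∷_ (map from (allFin d)) (vectors n)

  _⊛_ : ∀ {n} → (Vec D n → ℤ) → (Vec D n → ℤ) → Vec D n → ℤ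
  _⊛_ {n} g h v =
    sumℤ (map (λ (v₁ , v₂) → g v₁ ℤ.* h v₂)
      (filter (λ (v₁ , v₂) → Vec.≡-dec _≟ᴰ_ v (v₁ ⊕ v₂))
        (cartesianProduct (vectors n) (vectors n))))

  -- The instance (g , h , v) as an input: n, all values of g, all values of h,
  -- and the coordinates of v as indices in the enumeration of D.
  input : ∀ {n} → (Vec D n → ℤ) → (Vec D n → ℤ) → Vec D n → List (List ℤ)
  input {n} g h v =
      (+ n ∷ [])
    ∷ map g (vectors n)
    ∷ map h (vectors n)
    ∷ Vec.toList (Vec.map (λ x → + toℕ (to x)) v)
    ∷ []

  -- P solves the f-Query problem in time
  -- O(|D| ^ (ω n / 2) · (log |D| ^ n) ^ k · (log M) ^ k).
  SolvesQueryIn : ℝ → Cmd → ℕ → ℕ → Set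
  SolvesQueryIn ω P C k =
    ∀ (n : ℕ) (g h : Vec D n → ℤ) (v : Vec D n) (M : ℕ) →
    (∀ u → ∣ g u ∣ ≤ M) → (∀ u → ∣ h u ∣ ≤ M) →
    Computes P (input g h v) ((g ⊛ h) v ∷ [])
      (λ t → t ≤ C * bits (d ^ n) ^ k * bits M ^ k · d ^⟨ ω · n / 2 ⟩)

{-# OPTIONS --safe #-}

-- Let N = d ^ ⌈n/2⌉ and split v = v₁ ++ v₂ with v₁ of length ⌊n/2⌋.  Read in
-- lexicographic order, the values of g and h, padded with zeros, are N × N
-- matrices G and H, indexed by the two halves of a vector.  Let A₁ and A₂ be the
-- 0/1-matrices with entry 1 at (u , w) iff u ⊕ w is v₁ and v₂, respectively.  Then
-- (g ⊛ h) v is the sum of the entrywise product of G A₂ and A₁ H, so two products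
-- of N × N matrices suffice; everything else takes time N² up to logarithmic
-- factors.

module Submission where

open import Defs
open import Data.Bool using (Bool; true; false; if_then_else_; _∧_; not; T)
open import Data.Fin as Fin using (Fin; toℕ; zero; suc)
import Data.Fin.Properties as Fin
open import Data.Integer as ℤ using (ℤ; +_; -[1+_]; ∣_∣; 0ℤ; 1ℤ)
import Data.Integer.DivMod as ℤ
import Data.Integer.GCD as ℤ
import Data.Integer.Properties as ℤ
import Data.Integer.Tactic.RingSolver as ℤ-Solver
open import Data.List as List
  using (List; []; _∷_; _++_; map; length; filter; lookup; tabulate; allFin;
         cartesianProduct; cartesianProductWith)
import Data.List.Properties as List
open import Data.Nat
open import Data.Nat.Divisibility using (n∣m*n)
open import Data.Nat.DivMod
open import Data.Nat.Induction using (<-rec)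
open import Data.Nat.Logarithm
open import Data.Nat.Properties
open import Data.Nat.Tactic.RingSolver using (solve-∀)
open import Data.Product using (Σ-syntax; ∃; _×_; _,_; proj₁; proj₂)
open import Data.Rational as ℚ using (ℚ; mkℚ; ↥_; ↧_)
import Data.Rational.Properties as ℚ
open import Data.Sum using (_⊎_; inj₁; inj₂)
open import Data.Unit using (⊤; tt)
open import Data.Vec as Vec using (Vec; []; _∷_)
import Data.Vec.Properties as Vec
open import Function using (_∘_; id)
open import Function.Bundles using (_↔_; Inverse)
open import Level using (0ℓ)
open import Relation.Binary.PropositionalEquality hiding ([_])
open import Relation.Nullary
open import Relation.Nullary.Decidable using (does; dec-true; dec-false)
open import Relation.Unary using (Pred; Decidable)

-- Binary lengths

-- The difficulty lies less in the identity than in the model of computation. The multiplication is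
-- an unknown program that expects an otherwise empty memory, so its two copies are run on disjoint
-- families of arrays. Costs are logarithmic, so a bound on every number that the surrounding
-- program handles has to be carried along. The time bound is not a number: with a real exponent it
-- is one inequality for each rational above ω, and times are added and rescaled as such families.
-- For odd n, N² exceeds d ^ n by a factor d; since ω lies below some fixed rational, this costs
-- only a constant factor. For d ≤ 1 the bound leaves no room for n at all, not even for reading it,
-- and a single product of two input values settles that case.

log₂-< : ∀ a {x} → x < 2 ^ suc a → ⌊log₂ x ⌋ ≤ a
log₂-< zero    {zero}        x<2 = z≤n
log₂-< zero    {suc zero}    x<2 = z≤n
log₂-< zero    {suc (suc x)} (s≤s (s≤s ()))
log₂-< (suc a) {x}           x<2ᵃ =
  ≤-trans (m≤n+m∸n ⌊log₂ x ⌋ 1)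
    (s≤s (subst (_≤ a) (⌊log₂⌊n/2⌋⌋≡⌊log₂n⌋∸1 x)
      (log₂-< a (half x (2 ^ suc a) x<2ᵃ))))
  where
  half : ∀ x m → x < 2 * m → ⌊ x /2⌋ < m
  half zero          (suc m) _ = s≤s z≤n
  half (suc zero)    (suc m) _ = s≤s z≤n
  half (suc (suc x)) (suc m) p =
    s≤s (half x m (s≤s⁻¹ (s≤s⁻¹ (subst (suc (suc (suc x)) ≤_) (cong suc (+-suc m (m + 0))) p))))

bits-least : ∀ {x a} → 1 ≤ a → x < 2 ^ a → bits x ≤ a
bits-least {a = suc a} _ p = s≤s (log₂-< a p)

<2^bits : ∀ x → x < 2 ^ bits x
<2^bits = <-rec (λ x → x < 2 ^ bits x) step
  where
  step : ∀ x → (∀ {y} → y < x → y < 2 ^ bits y) → x < 2 ^ bits x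
  step zero          _   = s≤s z≤n
  step (suc zero)    _   = s≤s (s≤s z≤n)
  step x@(suc (suc y)) rec = begin-strict
    x                                     ≤⟨ s≤s (s≤s (y≤ y)) ⟩
    suc (2 * suc ⌊ y /2⌋)                 <⟨ subst (_≤ 2 * suc (suc ⌊ y /2⌋)) (*-suc 2 (suc ⌊ y /2⌋)) ≤-refl ⟩
    2 * suc ⌊ x /2⌋                       ≤⟨ *-monoʳ-≤ 2 (rec (s≤s (s≤s (⌊n/2⌋≤n y)))) ⟩
    2 * 2 ^ suc ⌊log₂ ⌊ x /2⌋ ⌋           ≡⟨ cong (λ z → 2 * 2 ^ suc z) (⌊log₂⌊n/2⌋⌋≡⌊log₂n⌋∸1 x) ⟩
    2 * 2 ^ suc (⌊log₂ x ⌋ ∸ 1)           ≡⟨ cong (λ z → 2 * 2 ^ z) (m+[n∸m]≡n {1} (⌊log₂⌋-mono-≤ {2} {x} (s≤s (s≤s z≤n)))) ⟩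
    2 ^ bits x                            ∎
    where
    open ≤-Reasoning
    y≤ : ∀ y → y ≤ ⌊ y /2⌋ + suc (⌊ y /2⌋ + 0)
    y≤ zero = z≤n
    y≤ (suc zero) = s≤s z≤n
    y≤ (suc (suc y)) = s≤s (≤-trans (s≤s (y≤ y)) (≤-reflexive (sym (+-suc ⌊ y /2⌋ (suc (⌊ y /2⌋ + 0))))))

bits-mono : ∀ {x y} → x ≤ y → bits x ≤ bits y
bits-mono p = s≤s (⌊log₂⌋-mono-≤ p)

1≤bits : ∀ x → 1 ≤ bits x
1≤bits x = s≤s z≤n

bits-* : ∀ x y → bits (x * y) ≤ bits x + bits y
bits-* x y = bits-least (≤-trans (1≤bits x) (m≤m+n _ _)) (begin-strict
  x * y                       <⟨ *-mono-< (<2^bits x) (<2^bits y) ⟩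
  2 ^ bits x * 2 ^ bits y     ≡⟨ ^-distribˡ-+-* 2 (bits x) (bits y) ⟨
  2 ^ (bits x + bits y)       ∎)
  where open ≤-Reasoning

-- The convention `bits 0 = 1` makes both lengths at least 1, which 2 ^ a + 2 ^ b ≤ 2 ^ (a + b)
-- requires.
bits-+ : ∀ x y → bits (x + y) ≤ bits x + bits y
bits-+ x y = bits-least (≤-trans (1≤bits x) (m≤m+n _ _)) (begin-strict
  x + y                       <⟨ +-mono-< (<2^bits x) (<2^bits y) ⟩
  2 ^ bits x + 2 ^ bits y     ≤⟨ +≤* (⌊log₂ x ⌋) (⌊log₂ y ⌋) ⟩
  2 ^ bits x * 2 ^ bits y     ≡⟨ ^-distribˡ-+-* 2 (bits x) (bits y) ⟨
  2 ^ (bits x + bits y)       ∎)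
  where
  open ≤-Reasoning
  +≤* : ∀ a b → 2 ^ suc a + 2 ^ suc b ≤ 2 ^ suc a * 2 ^ suc b
  +≤* a b with 2 ^ a | m^n>0 2 a | 2 ^ b | m^n>0 2 b
  -- With 2 ^ a = 1 + x and 2 ^ b = 1 + y the slack is the polynomial 2 (x + y + 2 x y).
  ... | suc x | _ | suc y | _ = subst (2 * suc x + 2 * suc y ≤_) (eq x y) (m≤m+n _ (2 * (x + y + 2 * (x * y))))
    where
    eq : ∀ x y → (2 * suc x + 2 * suc y) + 2 * (x + y + 2 * (x * y)) ≡ 2 * suc x * (2 * suc y)
    eq = solve-∀

bits-suc : ∀ x → bits (suc x) ≤ suc (bits x)
bits-suc = bits-+ 1

-- This lets the iterations of the digit and power loops disappear in the factor `bits (d ^ n)`. It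
-- breaks down for d ≤ 1 and n ≥ 1, hence the separate treatment of d ≤ 1.
≤bits-^ : ∀ d n → 2 ≤ d → suc n ≤ bits (d ^ n)
≤bits-^ d n 2≤d = s≤s (subst (_≤ ⌊log₂ d ^ n ⌋) (⌊log₂[2^n]⌋≡n n) (⌊log₂⌋-mono-≤ (^-monoˡ-≤ n 2≤d)))

len-⟦⟧ : ∀ o x y → len (⟦ o ⟧ x y) ≤ len x + len y
len-⟦⟧ add x y = ≤-trans (bits-mono (ℤ.∣i+j∣≤∣i∣+∣j∣ x y)) (bits-+ ∣ x ∣ ∣ y ∣)
len-⟦⟧ sub x y = ≤-trans (bits-mono (ℤ.∣i-j∣≤∣i∣+∣j∣ x y)) (bits-+ ∣ x ∣ ∣ y ∣)
len-⟦⟧ mul x y = ≤-trans (bits-mono (≤-reflexive (ℤ.∣i*j∣≡∣i∣*∣j∣ x y))) (bits-* ∣ x ∣ ∣ y ∣)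
len-⟦⟧ div x y = ≤-trans (bits-mono (∣div∣≤ x y)) (m≤m+n (len x) (len y))
  where
  -- A negative dividend with nonzero remainder is rounded away from zero. A nonzero remainder
  -- forces a divisor of at least 2, and then the rounded quotient still does not exceed the
  -- dividend in size.
  sucpred : ∀ {n} d .{{_ : NonZero d}} → suc n % d ≢ 0 → suc (suc n / d) ≤ suc n
  sucpred {n} (suc zero) p = contradiction (n%1≡0 (suc n)) p
  sucpred {n} (suc (suc d)) p = m/n<m (suc n) (suc (suc d)) (s≤s (s≤s z≤n))
  ∣/ℕ∣≤ : ∀ x d .{{_ : NonZero d}} → ∣ x ℤ./ℕ d ∣ ≤ ∣ x ∣
  ∣/ℕ∣≤ (+ n) d = m/n≤m n d
  ∣/ℕ∣≤ -[1+ n ] d with suc n % d in eq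
  ... | zero  = ≤-trans (≤-reflexive (ℤ.∣-i∣≡∣i∣ (+ (suc n / d)))) (m/n≤m (suc n) d)
  ... | suc r = sucpred d (λ e → 1+n≢0 (trans (sym eq) e))
  ∣div∣≤ : ∀ x y → ∣ ⟦ div ⟧ x y ∣ ≤ ∣ x ∣
  ∣div∣≤ x (+ zero)   = z≤n
  ∣div∣≤ x (+ suc n)  = subst (λ z → ∣ z ∣ ≤ ∣ x ∣) (sym (ℤ.div-pos-is-/ℕ x (suc n))) (∣/ℕ∣≤ x (suc n))
  ∣div∣≤ x -[1+ n ]   = subst (λ z → ∣ z ∣ ≤ ∣ x ∣) (sym (ℤ.div-neg-is-neg-/ℕ x (suc n)))
    (≤-trans (≤-reflexive (ℤ.∣-i∣≡∣i∣ (x ℤ./ℕ suc n))) (∣/ℕ∣≤ x (suc n)))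

div-ℕ : ∀ x y .{{_ : NonZero y}} → ⟦ div ⟧ (+ x) (+ y) ≡ + (x / y)
div-ℕ x (suc y) = ℤ.div-pos-is-/ℕ (+ x) (suc y)

mod-ℕ : ∀ x y .{{_ : NonZero y}} → + x ℤ.- ⟦ div ⟧ (+ x) (+ y) ℤ.* + y ≡ + (x % y)
mod-ℕ x y = begin
  + x ℤ.- ⟦ div ⟧ (+ x) (+ y) ℤ.* + y                  ≡⟨ cong (λ z → + x ℤ.- z ℤ.* + y) (div-ℕ x y) ⟩
  + x ℤ.- + (x / y) ℤ.* + y                            ≡⟨ cong (λ z → + x ℤ.- z) (sym (ℤ.pos-* (x / y) y)) ⟩
  + x ℤ.- + (x / y * y)                                ≡⟨ cong (λ z → + z ℤ.- + (x / y * y)) (m≡m%n+[m/n]*n x y) ⟩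
  + (x % y + x / y * y) ℤ.- + (x / y * y)              ≡⟨⟩
  (+ (x % y) ℤ.+ + (x / y * y)) ℤ.- + (x / y * y)      ≡⟨ ℤ.+-assoc (+ (x % y)) (+ (x / y * y)) (ℤ.- + (x / y * y)) ⟩
  + (x % y) ℤ.+ (+ (x / y * y) ℤ.- + (x / y * y))      ≡⟨ cong (λ z → + (x % y) ℤ.+ z) (ℤ.+-inverseʳ (+ (x / y * y))) ⟩
  + (x % y) ℤ.+ + 0                                    ≡⟨ ℤ.+-identityʳ _ ⟩
  + (x % y)                                            ∎
  where open ≡-Reasoning

-- Sums

private variable
  A B Z : Set

-- Splitting off the last term fits loops that count down: entered with counter `suc k`, the
-- summation loop treats index `k` first. Rows and columns are summed with `sum`, vectors with
-- `sumOver`; `sum-index` translates.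
sum : ℕ → (ℕ → ℤ) → ℤ
sum zero    F = 0ℤ
sum (suc k) F = sum k F ℤ.+ F k

sum-cong : ∀ n {F G : ℕ → ℤ} → (∀ i → i < n → F i ≡ G i) → sum n F ≡ sum n G
sum-cong zero    eq = refl
sum-cong (suc n) eq = cong₂ ℤ._+_ (sum-cong n (λ i p → eq i (m<n⇒m<1+n p))) (eq n ≤-refl)

sum-zero : ∀ n {F : ℕ → ℤ} → (∀ i → F i ≡ 0ℤ) → sum n F ≡ 0ℤ
sum-zero zero    eq = refl
sum-zero (suc n) eq = cong₂ ℤ._+_ (sum-zero n eq) (eq n)

sum-+ : ∀ a b F → sum (a + b) F ≡ sum a F ℤ.+ sum b (λ i → F (a + i))
sum-+ a zero    F rewrite +-identityʳ a = sym (ℤ.+-identityʳ _)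
sum-+ a (suc b) F rewrite +-suc a b =
  trans (cong (λ z → z ℤ.+ F (a + b)) (sum-+ a b F)) (ℤ.+-assoc (sum a F) _ _)

sum-* : ∀ a b F → sum (a * b) F ≡ sum a (λ i → sum b (λ j → F (i * b + j)))
sum-* zero    b F = refl
sum-* (suc a) b F = begin
  sum (b + a * b) F                                  ≡⟨ cong (λ z → sum z F) (+-comm b (a * b)) ⟩
  sum (a * b + b) F                                  ≡⟨ sum-+ (a * b) b F ⟩
  sum (a * b) F ℤ.+ sum b (λ j → F (a * b + j))      ≡⟨ cong (λ z → z ℤ.+ sum b (λ j → F (a * b + j))) (sum-* a b F) ⟩
  _                                                  ∎
  where open ≡-Reasoning

-- Used to discard the rows of zeros with which the matrices are padded.
sum-truncate : ∀ {a b} F → a ≤ b → (∀ i → a ≤ i → F i ≡ 0ℤ) → sum b F ≡ sum a F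
sum-truncate {a} {b} F a≤b eq = begin
  sum b F                                       ≡⟨ cong (λ z → sum z F) (sym (m+[n∸m]≡n a≤b)) ⟩
  sum (a + (b ∸ a)) F                           ≡⟨ sum-+ a (b ∸ a) F ⟩
  sum a F ℤ.+ sum (b ∸ a) (λ i → F (a + i))     ≡⟨ cong (λ z → sum a F ℤ.+ z) (sum-zero (b ∸ a) (λ i → eq (a + i) (m≤m+n a i))) ⟩
  sum a F ℤ.+ 0ℤ                                ≡⟨ ℤ.+-identityʳ _ ⟩
  sum a F                                       ∎
  where open ≡-Reasoning

sum-head : ∀ k F → sum (suc k) F ≡ F 0 ℤ.+ sum k (F ∘ suc)
sum-head k F = trans (sum-+ 1 k F) (cong (λ z → z ℤ.+ sum k (F ∘ suc)) (ℤ.+-identityˡ (F 0)))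

∣sum∣≤ : ∀ n (F : ℕ → ℤ) K → (∀ i → i < n → ∣ F i ∣ ≤ K) → ∣ sum n F ∣ ≤ n * K
∣sum∣≤ zero    F K b = z≤n
∣sum∣≤ (suc n) F K b = ≤-trans (ℤ.∣i+j∣≤∣i∣+∣j∣ (sum n F) (F n))
  (≤-trans (+-mono-≤ (∣sum∣≤ n F K (λ i p → b i (m<n⇒m<1+n p))) (b n ≤-refl)) (≤-reflexive (+-comm (n * K) K)))

sumOver : List A → (A → ℤ) → ℤ
sumOver xs F = sumℤ (map F xs)

sumOver-cong : ∀ (xs : List A) {F G} → (∀ x → F x ≡ G x) → sumOver xs F ≡ sumOver xs G
sumOver-cong xs eq = cong sumℤ (List.map-cong eq xs)

sumOver-++ : ∀ (xs ys : List A) F → sumOver (xs ++ ys) F ≡ sumOver xs F ℤ.+ sumOver ys F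
sumOver-++ []       ys F = sym (ℤ.+-identityˡ _)
sumOver-++ (x ∷ xs) ys F = trans (cong (λ z → F x ℤ.+ z) (sumOver-++ xs ys F)) (sym (ℤ.+-assoc (F x) _ _))

sumOver-map : ∀ (k : A → B) xs F → sumOver (map k xs) F ≡ sumOver xs (F ∘ k)
sumOver-map k xs F = cong sumℤ (sym (List.map-∘ xs))

sumOver-product : ∀ (k : A → B → Z) xs ys F →
  sumOver (cartesianProductWith k xs ys) F ≡ sumOver xs (λ x → sumOver ys (λ y → F (k x y)))
sumOver-product k []       ys F = refl
sumOver-product k (x ∷ xs) ys F = trans (sumOver-++ (map (k x) ys) _ F)
  (cong₂ ℤ._+_ (sumOver-map (k x) ys F) (sumOver-product k xs ys F))

⟦_⟧₀₁ : Bool → ℤ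
⟦ b ⟧₀₁ = if b then 1ℤ else 0ℤ

⟦∧⟧₀₁ : ∀ a b → ⟦ a ∧ b ⟧₀₁ ≡ ⟦ a ⟧₀₁ ℤ.* ⟦ b ⟧₀₁
⟦∧⟧₀₁ true  b = sym (ℤ.*-identityˡ _)
⟦∧⟧₀₁ false b = refl

sumOver-filter : ∀ {P : Pred A 0ℓ} (P? : Decidable P) xs F →
  sumOver (filter P? xs) F ≡ sumOver xs (λ x → ⟦ does (P? x) ⟧₀₁ ℤ.* F x)
sumOver-filter P? []       F = refl
sumOver-filter P? (x ∷ xs) F with does (P? x)
... | true  = cong₂ ℤ._+_ (sym (ℤ.*-identityˡ (F x))) (sumOver-filter P? xs F)
... | false = trans (sumOver-filter P? xs F) (sym (ℤ.+-identityˡ _))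

*-sumOver : ∀ c (xs : List A) F → c ℤ.* sumOver xs F ≡ sumOver xs (λ x → c ℤ.* F x)
*-sumOver c []       F = ℤ.*-zeroʳ c
*-sumOver c (x ∷ xs) F = trans (ℤ.*-distribˡ-+ c (F x) _) (cong (λ z → c ℤ.* F x ℤ.+ z) (*-sumOver c xs F))

sumOver-+ : ∀ (xs : List A) F G → sumOver xs (λ x → F x ℤ.+ G x) ≡ sumOver xs F ℤ.+ sumOver xs G
sumOver-+ []       F G = refl
sumOver-+ (x ∷ xs) F G = trans (cong (λ z → F x ℤ.+ G x ℤ.+ z) (sumOver-+ xs F G)) (interchange (F x) (G x) _ _)
  where
  interchange : ∀ a b c d → (a ℤ.+ b) ℤ.+ (c ℤ.+ d) ≡ (a ℤ.+ c) ℤ.+ (b ℤ.+ d)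
  interchange = ℤ-Solver.solve-∀

sumOver-0 : ∀ (xs : List A) → sumOver xs (λ _ → 0ℤ) ≡ 0ℤ
sumOver-0 []       = refl
sumOver-0 (x ∷ xs) = trans (ℤ.+-identityˡ _) (sumOver-0 xs)

sumOver-swap : ∀ (xs : List A) (ys : List B) (F : A → B → ℤ) →
  sumOver xs (λ x → sumOver ys (F x)) ≡ sumOver ys (λ y → sumOver xs (λ x → F x y))
sumOver-swap []       ys F = sym (sumOver-0 ys)
sumOver-swap (x ∷ xs) ys F = trans (cong (λ z → sumOver ys (F x) ℤ.+ z) (sumOver-swap xs ys F))
  (sym (sumOver-+ ys (F x) (λ y → sumOver xs (λ x → F x y))))

sumOver-*-sumOver : ∀ (xs : List A) (ys : List B) F G →
  sumOver xs F ℤ.* sumOver ys G ≡ sumOver xs (λ x → sumOver ys (λ y → F x ℤ.* G y))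
sumOver-*-sumOver xs ys F G = begin
  sumOver xs F ℤ.* sumOver ys G                          ≡⟨ ℤ.*-comm (sumOver xs F) _ ⟩
  sumOver ys G ℤ.* sumOver xs F                          ≡⟨ *-sumOver (sumOver ys G) xs F ⟩
  sumOver xs (λ x → sumOver ys G ℤ.* F x)                ≡⟨ sumOver-cong xs (λ x → trans (ℤ.*-comm _ (F x)) (*-sumOver (F x) ys G)) ⟩
  sumOver xs (λ x → sumOver ys (λ y → F x ℤ.* G y))      ∎
  where open ≡-Reasoning

sumOver-tabulate : ∀ m {F : A → ℤ} {G : ℕ → ℤ} (k : Fin m → A) → (∀ i → F (k i) ≡ G (toℕ i)) →
  sumOver (tabulate k) F ≡ sum m G
sumOver-tabulate zero    k eq = refl
sumOver-tabulate (suc m) {F} {G} k eq = trans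
  (cong₂ ℤ._+_ (eq zero) (sumOver-tabulate m (k ∘ suc) (eq ∘ suc))) (sym (sum-head m G))

sumOver-allFin : ∀ m (F : ℕ → ℤ) → sumOver (allFin m) (F ∘ toℕ) ≡ sum m F
sumOver-allFin m F = sumOver-tabulate m id (λ _ → refl)

-- Positions in lists and row-major storage

infix 4 _∋_↦_

-- Unlike an equation about `nth`, such a proof carries the bound on the position, so it passes
-- through `++` and products without side conditions or default values.
data _∋_↦_ {A : Set} : List A → ℕ → A → Set where
  here  : ∀ {x xs} → x ∷ xs ∋ 0 ↦ x
  there : ∀ {x y xs i} → xs ∋ i ↦ x → y ∷ xs ∋ suc i ↦ x

∋⇒nth : ∀ {z : A} {xs i x} → xs ∋ i ↦ x → nth z xs i ≡ x
∋⇒nth here      = refl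
∋⇒nth (there p) = ∋⇒nth p

nth-≥ : ∀ {z : A} xs i → length xs ≤ i → nth z xs i ≡ z
nth-≥ []       i       _       = refl
nth-≥ (x ∷ xs) (suc i) (s≤s p) = nth-≥ xs i p

nth-lookup : ∀ {z : A} xs i → nth z xs (toℕ i) ≡ lookup xs i
nth-lookup (x ∷ xs) zero    = refl
nth-lookup (x ∷ xs) (suc i) = nth-lookup xs i

∋-map : ∀ (k : A → B) {xs i x} → xs ∋ i ↦ x → map k xs ∋ i ↦ k x
∋-map k here      = here
∋-map k (there p) = there (∋-map k p)

∋-++ˡ : ∀ {xs ys i} {x : A} → xs ∋ i ↦ x → xs ++ ys ∋ i ↦ x
∋-++ˡ here      = here
∋-++ˡ (there p) = there (∋-++ˡ p)

∋-++ʳ : ∀ xs {ys i} {x : A} → ys ∋ i ↦ x → xs ++ ys ∋ length xs + i ↦ x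
∋-++ʳ []       p = p
∋-++ʳ (_ ∷ xs) p = there (∋-++ʳ xs p)

-- The common source of the addresses of matrix entries and of vectors, as `rowMajor` and `vectors`
-- are both built by `cartesianProductWith`.
∋-product : ∀ (k : A → B → Z) {xs ys i j x y} → xs ∋ i ↦ x → ys ∋ j ↦ y →
  cartesianProductWith k xs ys ∋ i * length ys + j ↦ k x y
∋-product k         here      q = ∋-++ˡ (∋-map (k _) q)
∋-product k {ys = ys} {j = j} {x} {y} (there {y = z} {xs} {i} p) q =
  subst (λ l → map (k z) ys ++ cartesianProductWith k xs ys ∋ l ↦ k x y)
    (trans (cong (_+ (i * length ys + j)) (List.length-map (k z) ys)) (sym (+-assoc (length ys) _ j)))
    (∋-++ʳ (map (k z) ys) (∋-product k p q))

∋-tabulate : ∀ {m} (k : Fin m → A) i → tabulate k ∋ toℕ i ↦ k i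
∋-tabulate k zero    = here
∋-tabulate k (suc i) = there (∋-tabulate (k ∘ suc) i)

length-product : ∀ (k : A → B → Z) xs ys →
  length (cartesianProductWith k xs ys) ≡ length xs * length ys
length-product k []       ys = refl
length-product k (x ∷ xs) ys = trans (List.length-++ (map (k x) ys))
  (cong₂ _+_ (List.length-map (k x) ys) (length-product k xs ys))

length-allFin : ∀ m → length (allFin m) ≡ m
length-allFin m = List.length-tabulate id

nth-rowMajor : ∀ {m} (A : Matrix m) i j → nth 0ℤ (rowMajor A) (toℕ i * m + toℕ j) ≡ A i j
nth-rowMajor {m} A i j = ∋⇒nth (subst (λ l → rowMajor A ∋ toℕ i * l + toℕ j ↦ A i j) (length-allFin m)
  (∋-product A (∋-tabulate id i) (∋-tabulate id j)))

length-rowMajor : ∀ {m} (A : Matrix m) → length (rowMajor A) ≡ m * m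
length-rowMajor {m} A = trans (length-product A (allFin m) (allFin m)) (cong₂ _*_ (length-allFin m) (length-allFin m))

matrix : ∀ m → (ℕ → ℕ → ℤ) → Matrix m
matrix m φ i j = φ (toℕ i) (toℕ j)

nth-entry : ∀ {m} (A : Matrix m) (φ : ℕ → ℕ → ℤ) → (∀ i j → A i j ≡ φ (toℕ i) (toℕ j)) →
  ∀ {i j} → i < m → j < m → nth 0ℤ (rowMajor A) (i * m + j) ≡ φ i j
nth-entry {m} A φ eq {i} {j} i<m j<m = begin
  nth 0ℤ (rowMajor A) (i * m + j)              ≡⟨ cong₂ (λ a b → nth 0ℤ (rowMajor A) (a * m + b)) (Fin.toℕ-fromℕ< i<m) (Fin.toℕ-fromℕ< j<m) ⟨
  nth 0ℤ (rowMajor A) (toℕ i′ * m + toℕ j′)    ≡⟨ nth-rowMajor A i′ j′ ⟩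
  A i′ j′                                      ≡⟨ eq i′ j′ ⟩
  φ (toℕ i′) (toℕ j′)                          ≡⟨ cong₂ φ (Fin.toℕ-fromℕ< i<m) (Fin.toℕ-fromℕ< j<m) ⟩
  φ i j                                        ∎
  where
  open ≡-Reasoning
  i′ = Fin.fromℕ< i<m
  j′ = Fin.fromℕ< j<m

-- The form that the loops need: they run over one counter and recover row and column by division.
nth-entry-/% : ∀ {m} .{{_ : NonZero m}} (A : Matrix m) (φ : ℕ → ℕ → ℤ) → (∀ i j → A i j ≡ φ (toℕ i) (toℕ j)) →
  ∀ {t} → t < m * m → nth 0ℤ (rowMajor A) t ≡ φ (t / m) (t % m)
nth-entry-/% {m} A φ eq {t} t<m² = trans
  (cong (nth 0ℤ (rowMajor A)) (trans (m≡m%n+[m/n]*n t m) (+-comm (t % m) _)))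
  (nth-entry A φ eq (m<n*o⇒m/o<n t<m²) (m%n<n t m))

⊗-matrix : ∀ m φ ψ i j → (matrix m φ ⊗ matrix m ψ) i j ≡ sum m (λ k → φ (toℕ i) k ℤ.* ψ k (toℕ j))
⊗-matrix m φ ψ i j = sumOver-allFin m (λ k → φ (toℕ i) k ℤ.* ψ k (toℕ j))

-- Truncated division gives 1 / (1 + z²) = 0 unless z = 0.
is0 : ℤ → ℤ
is0 z = ⟦ div ⟧ 1ℤ (1ℤ ℤ.+ z ℤ.* z)

is0-≢ : ∀ z → z ≢ 0ℤ → is0 z ≡ 0ℤ
is0-≢ (+ zero)   p = contradiction refl p
is0-≢ (+ suc n)  p = trans (div-ℕ 1 (2 + (n + n * suc n))) (cong +_ (m<n⇒m/n≡0 {1} {2 + (n + n * suc n)} (s≤s (s≤s z≤n))))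
is0-≢ -[1+ n ]   p = trans (div-ℕ 1 (2 + (n + n * suc n))) (cong +_ (m<n⇒m/n≡0 {1} {2 + (n + n * suc n)} (s≤s (s≤s z≤n))))

∣is0∣≤1 : ∀ z → ∣ is0 z ∣ ≤ 1
∣is0∣≤1 z with z ℤ.≟ 0ℤ
... | yes refl = ≤-refl
... | no  z≢0  rewrite is0-≢ z z≢0 = z≤n

is0-toℕ : ∀ {m} (i j : Fin m) → is0 (+ toℕ j ℤ.- + toℕ i) ≡ ⟦ does (i Fin.≟ j) ⟧₀₁
is0-toℕ i j with i Fin.≟ j
... | yes refl = cong is0 (ℤ.+-inverseʳ (+ toℕ i))
... | no  i≢j  = is0-≢ (+ toℕ j ℤ.- + toℕ i)
  (λ e → i≢j (sym (Fin.toℕ-injective (ℤ.+-injective (ℤ.i-j≡0⇒i≡j (+ toℕ j) (+ toℕ i) e)))))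

[m*n+o]/n : ∀ m {n o} .{{_ : NonZero n}} → o < n → (m * n + o) / n ≡ m
[m*n+o]/n m {n} {o} o<n = begin
  (m * n + o) / n      ≡⟨ +-distrib-/-∣ˡ o (n∣m*n m) ⟩
  m * n / n + o / n    ≡⟨ cong₂ _+_ (m*n/n≡m m n) (m<n⇒m/n≡0 o<n) ⟩
  m + 0                ≡⟨ +-identityʳ m ⟩
  m                    ∎
  where open ≡-Reasoning

[m*n+o]%n : ∀ m {n o} .{{_ : NonZero n}} → o < n → (m * n + o) % n ≡ o
[m*n+o]%n m {n} {o} o<n = begin
  (m * n + o) % n    ≡⟨ cong (_% n) (+-comm (m * n) o) ⟩
  (o + m * n) % n    ≡⟨ [m+kn]%n≡m%n o m n ⟩
  o % n              ≡⟨ m<n⇒m%n≡m o<n ⟩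
  o                  ∎
  where open ≡-Reasoning

-- The convolution at one vector in terms of two matrix products

module Query {D : Set} {d : ℕ} .{{d≢0 : NonZero d}} (enum : D ↔ Fin d) (f : D → D → D) where

  open FQuery enum f
  open ≡-Reasoning
  open Inverse enum using (to; from; strictlyInverseʳ)

  code : D → ℤ
  code x = + toℕ (to x)

  index : ∀ {n} → Vec D n → ℕ
  index []            = 0
  index {suc n} (a ∷ u) = toℕ (to a) * d ^ n + index u

  index-< : ∀ {n} (u : Vec D n) → index u < d ^ n
  index-< []                = s≤s z≤n
  index-< {suc n} (a ∷ u) = <-≤-trans (+-monoʳ-< (toℕ (to a) * d ^ n) (index-< u))
    (≤-trans (≤-reflexive (+-comm _ (d ^ n))) (*-monoˡ-≤ (d ^ n) (Fin.toℕ<n (to a))))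

  -- Consequently the list of values of g already is a row-major matrix with rows of length `d ^ p`,
  -- the first half of a vector being the row and the second the column. No entry has to be moved.
  index-++ : ∀ {q p} (u : Vec D q) (w : Vec D p) → index (u Vec.++ w) ≡ index u * d ^ p + index w
  index-++ []                    w = refl
  index-++ {suc q} {p} (a ∷ u) w = begin
    α * d ^ (q + p) + index (u Vec.++ w)              ≡⟨ cong₂ (λ y z → α * y + z) (^-distribˡ-+-* d q p) (index-++ u w) ⟩
    α * (d ^ q * d ^ p) + (index u * d ^ p + index w) ≡⟨ cong (_+ (index u * d ^ p + index w)) (sym (*-assoc α _ _)) ⟩
    α * d ^ q * d ^ p + (index u * d ^ p + index w)   ≡⟨ sym (+-assoc (α * d ^ q * d ^ p) _ _) ⟩
    α * d ^ q * d ^ p + index u * d ^ p + index w     ≡⟨ cong (_+ index w) (sym (*-distribʳ-+ (d ^ p) (α * d ^ q) _)) ⟩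
    (α * d ^ q + index u) * d ^ p + index w           ∎
    where α = toℕ (to a)

  length-vectors : ∀ n → length (vectors n) ≡ d ^ n
  length-vectors zero    = refl
  length-vectors (suc n) = trans (length-product _∷_ (map from (allFin d)) (vectors n))
    (cong₂ _*_ (trans (List.length-map from (allFin d)) (length-allFin d)) (length-vectors n))

  vectors-∋ : ∀ {n} (u : Vec D n) → vectors n ∋ index u ↦ u
  vectors-∋ []              = here
  vectors-∋ {suc n} (a ∷ u) = subst (λ l → vectors (suc n) ∋ toℕ (to a) * l + index u ↦ a ∷ u) (length-vectors n)
    (∋-product _∷_ (subst (map from (allFin d) ∋ toℕ (to a) ↦_) (strictlyInverseʳ a) (∋-map from (∋-tabulate id (to a)))) (vectors-∋ u))

  values : ∀ {n} → (Vec D n → ℤ) → ℕ → ℤ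
  values {n} g = nth 0ℤ (map g (vectors n))

  values-index : ∀ {n} (g : Vec D n → ℤ) u → values g (index u) ≡ g u
  values-index g u = ∋⇒nth (∋-map g (vectors-∋ u))

  -- The default 0 of `nth`, like that of the memory, serves as the zero padding.
  values-≥ : ∀ {n} (g : Vec D n → ℤ) {i} → d ^ n ≤ i → values g i ≡ 0ℤ
  values-≥ {n} g {i} p = nth-≥ (map g (vectors n)) i
    (≤-trans (≤-reflexive (trans (List.length-map g (vectors n)) (length-vectors n))) p)

  sumOver-from : ∀ (F : ℕ → ℤ) → sumOver (map from (allFin d)) (F ∘ toℕ ∘ to) ≡ sum d F
  sumOver-from F = trans (sumOver-map from (allFin d) (F ∘ toℕ ∘ to))
    (sumOver-tabulate d id (λ i → cong (F ∘ toℕ) (Inverse.strictlyInverseˡ enum i)))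

  sum-index : ∀ n (F : ℕ → ℤ) → sum (d ^ n) F ≡ sumOver (vectors n) (F ∘ index)
  sum-index zero    F = trans (ℤ.+-identityˡ (F 0)) (sym (ℤ.+-identityʳ (F 0)))
  sum-index (suc n) F = begin
    sum (d * d ^ n) F                                                       ≡⟨ sum-* d (d ^ n) F ⟩
    sum d (λ i → sum (d ^ n) (λ j → F (i * d ^ n + j)))                     ≡⟨ sum-cong d (λ i _ → sum-index n (λ j → F (i * d ^ n + j))) ⟩
    sum d (λ i → sumOver (vectors n) (λ u → F (i * d ^ n + index u)))       ≡⟨ sumOver-from (λ i → sumOver (vectors n) (λ u → F (i * d ^ n + index u))) ⟨
    sumOver (map from (allFin d)) (λ a → sumOver (vectors n) (λ u → F (index (a ∷ u))))  ≡⟨ sumOver-product _∷_ (map from (allFin d)) (vectors n) (F ∘ index) ⟨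
    sumOver (vectors (suc n)) (F ∘ index)                                   ∎

  sumOver-vectors-+ : ∀ q p F → sumOver (vectors (q + p)) F ≡
    sumOver (vectors q) (λ u → sumOver (vectors p) (λ w → F (u Vec.++ w)))
  sumOver-vectors-+ zero    p F = sym (ℤ.+-identityʳ _)
  sumOver-vectors-+ (suc q) p F = begin
    sumOver (vectors (suc q + p)) F
      ≡⟨ sumOver-product _∷_ letters (vectors (q + p)) F ⟩
    sumOver letters (λ a → sumOver (vectors (q + p)) (λ u → F (a ∷ u)))
      ≡⟨ sumOver-cong letters (λ a → sumOver-vectors-+ q p (λ u → F (a ∷ u))) ⟩
    sumOver letters (λ a → sumOver (vectors q) (λ u → sumOver (vectors p) (λ w → F (a ∷ u Vec.++ w))))
      ≡⟨ sumOver-product _∷_ letters (vectors q) (λ u → sumOver (vectors p) (λ w → F (u Vec.++ w))) ⟨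
    sumOver (vectors (suc q)) (λ u → sumOver (vectors p) (λ w → F (u Vec.++ w)))
      ∎
    where letters = map from (allFin d)

  match : ∀ {n} → Vec D n → Vec D n → Vec D n → ℤ
  match v u w = ⟦ does (Vec.≡-dec _≟ᴰ_ v (u ⊕ w)) ⟧₀₁

  -- As `⊕` acts coordinatewise, the indicator has one factor for the first halves and one for the
  -- second. This separation is the source of the algorithm.
  match-++ : ∀ {q p} (v u w : Vec D q) (v′ u′ w′ : Vec D p) →
    match (v Vec.++ v′) (u Vec.++ u′) (w Vec.++ w′) ≡ match v u w ℤ.* match v′ u′ w′
  match-++ []      []      []      v′ u′ w′ = sym (ℤ.*-identityˡ (match v′ u′ w′))
  match-++ (c ∷ v) (a ∷ u) (b ∷ w) v′ u′ w′ = begin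
    ⟦ α ∧ _ ⟧₀₁                                            ≡⟨ ⟦∧⟧₀₁ α _ ⟩
    ⟦ α ⟧₀₁ ℤ.* match (v Vec.++ v′) (u Vec.++ u′) (w Vec.++ w′)
                                                           ≡⟨ cong (λ z → ⟦ α ⟧₀₁ ℤ.* z) (match-++ v u w v′ u′ w′) ⟩
    ⟦ α ⟧₀₁ ℤ.* (match v u w ℤ.* match v′ u′ w′)           ≡⟨ ℤ.*-assoc ⟦ α ⟧₀₁ (match v u w) (match v′ u′ w′) ⟨
    (⟦ α ⟧₀₁ ℤ.* match v u w) ℤ.* match v′ u′ w′           ≡⟨ cong (λ z → z ℤ.* match v′ u′ w′) (⟦∧⟧₀₁ α _) ⟨
    match (c ∷ v) (a ∷ u) (b ∷ w) ℤ.* match v′ u′ w′       ∎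
    where α = does (c ≟ᴰ f a b)

  ⊛-match : ∀ {n} (g h : Vec D n → ℤ) v → (g ⊛ h) v ≡
    sumOver (vectors n) (λ u → sumOver (vectors n) (λ w → match v u w ℤ.* (g u ℤ.* h w)))
  ⊛-match {n} g h v = trans
    (sumOver-filter (λ (u , w) → Vec.≡-dec _≟ᴰ_ v (u ⊕ w)) (cartesianProduct (vectors n) (vectors n)) (λ (u , w) → g u ℤ.* h w))
    (sumOver-product _,_ (vectors n) (vectors n) (λ (u , w) → match v u w ℤ.* (g u ℤ.* h w)))

  -- Fix the first half `u` of the argument of g and the second half `w′` of that of h. The
  -- remaining halves `u′` and `w` are then independent of each other: one condition links `u′` with
  -- `w′`, the other `u` with `w`. Hence the inner double sum factors, and its factors are entries
  -- at (`u` , `w′`) of two matrix products.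
  ⊛-++ : ∀ {q p} (g h : Vec D (q + p) → ℤ) v v′ → (g ⊛ h) (v Vec.++ v′) ≡
    sumOver (vectors q) (λ u → sumOver (vectors p) (λ w′ →
      sumOver (vectors p) (λ u′ → g (u Vec.++ u′) ℤ.* match v′ u′ w′) ℤ.*
      sumOver (vectors q) (λ w → match v u w ℤ.* h (w Vec.++ w′))))
  ⊛-++ {q} {p} g h v v′ = begin
    (g ⊛ h) (v Vec.++ v′)
      ≡⟨ ⊛-match g h (v Vec.++ v′) ⟩
    sumOver (vectors (q + p)) (λ u → sumOver (vectors (q + p)) (λ w → match (v Vec.++ v′) u w ℤ.* (g u ℤ.* h w)))
      ≡⟨ sumOver-vectors-+ q p _ ⟩
    sumOver Q (λ u → sumOver P (λ u′ → sumOver (vectors (q + p)) (λ w → match (v Vec.++ v′) (u Vec.++ u′) w ℤ.* (g (u Vec.++ u′) ℤ.* h w))))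
      ≡⟨ sumOver-cong Q (λ u → begin
           sumOver P (λ u′ → sumOver (vectors (q + p)) (λ w → match (v Vec.++ v′) (u Vec.++ u′) w ℤ.* (g (u Vec.++ u′) ℤ.* h w)))
             ≡⟨ sumOver-cong P (λ u′ → begin
                  _ ≡⟨ sumOver-vectors-+ q p _ ⟩
                  _ ≡⟨ sumOver-cong Q (λ w → sumOver-cong P (λ w′ → term u u′ w w′)) ⟩
                  _ ≡⟨ sumOver-swap Q P _ ⟩
                  _ ∎) ⟩
           sumOver P (λ u′ → sumOver P (λ w′ → sumOver Q (λ w → (g (u Vec.++ u′) ℤ.* match v′ u′ w′) ℤ.* (match v u w ℤ.* h (w Vec.++ w′)))))
             ≡⟨ sumOver-swap P P _ ⟩
           sumOver P (λ w′ → sumOver P (λ u′ → sumOver Q (λ w → (g (u Vec.++ u′) ℤ.* match v′ u′ w′) ℤ.* (match v u w ℤ.* h (w Vec.++ w′)))))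
             ≡⟨ sumOver-cong P (λ w′ → sumOver-*-sumOver P Q _ _) ⟨
           _ ∎) ⟩
    _ ∎
    where
    Q = vectors q
    P = vectors p
    rearrange : ∀ a b c e → (a ℤ.* b) ℤ.* (c ℤ.* e) ≡ (c ℤ.* b) ℤ.* (a ℤ.* e)
    rearrange = ℤ-Solver.solve-∀
    term : ∀ u u′ w w′ → match (v Vec.++ v′) (u Vec.++ u′) (w Vec.++ w′) ℤ.* (g (u Vec.++ u′) ℤ.* h (w Vec.++ w′)) ≡
      (g (u Vec.++ u′) ℤ.* match v′ u′ w′) ℤ.* (match v u w ℤ.* h (w Vec.++ w′))
    term u u′ w w′ = trans (cong (λ z → z ℤ.* (g (u Vec.++ u′) ℤ.* h (w Vec.++ w′))) (match-++ v u w v′ u′ w′))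
      (rearrange (match v u w) (match v′ u′ w′) (g (u Vec.++ u′)) (h (w Vec.++ w′)))

  -- As f is fixed and not part of the input, its values are written into the program as constants,
  -- to be read by `select`.
  table : List ℤ
  table = rowMajor {d} (λ i j → code (f (from i) (from j)))

  nth-table : ∀ a b → nth 0ℤ table (toℕ (to a) * d + toℕ (to b)) ≡ code (f a b)
  nth-table a b = trans (nth-rowMajor (λ i j → code (f (from i) (from j))) (to a) (to b))
    (cong₂ (λ a b → code (f a b)) (strictlyInverseʳ a) (strictlyInverseʳ b))

  -- χ c k j x y is 1 if x and y are the indices of two vectors in D ^ k whose
  -- f-sum has the codes c j, …, c (j + k - 1), and 0 if they are not.
  χ : (ℤ → ℤ) → ℕ → ℕ → ℕ → ℕ → ℤ
  χ c zero    j x y = 1ℤ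
  χ c (suc k) j x y = let instance _ = m^n≢0 d k in
    is0 (nth 0ℤ table (x / d ^ k * d + y / d ^ k) ℤ.- c (+ j)) ℤ.* χ c k (suc j) (x % d ^ k) (y % d ^ k)

  ∣χ∣≤1 : ∀ c k j x y → ∣ χ c k j x y ∣ ≤ 1
  ∣χ∣≤1 c zero    j x y = ≤-refl
  ∣χ∣≤1 c (suc k) j x y = ≤-trans (≤-reflexive (ℤ.∣i*j∣≡∣i∣*∣j∣ (is0 z) _))
    (*-mono-≤ (∣is0∣≤1 z) (∣χ∣≤1 c k (suc j) (x % d ^ k) (y % d ^ k)))
    where
    instance _ = m^n≢0 d k
    z = nth 0ℤ table (x / d ^ k * d + y / d ^ k) ℤ.- c (+ j)

  -- The offset `j` makes the statement pass to both halves of a vector; the second half is read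
  -- from position `q` on.
  Codes : (ℤ → ℤ) → ℕ → ∀ {k} → Vec D k → Set
  Codes c j []      = ⊤
  Codes c j (x ∷ v) = c (+ j) ≡ code x × Codes c (suc j) v

  codes : ∀ (c : ℤ → ℤ) j {k} (v : Vec D k) →
    (∀ i → c (+ (j + i)) ≡ nth 0ℤ (Vec.toList (Vec.map code v)) i) → Codes c j v
  codes c j []      eq = tt
  codes c j (x ∷ v) eq = trans (cong (λ z → c (+ z)) (sym (+-identityʳ j))) (eq 0) ,
    codes c (suc j) v (λ i → trans (cong (λ z → c (+ z)) (sym (+-suc j i))) (eq (suc i)))

  Codes-++ : ∀ c j {q p} (v : Vec D q) (v′ : Vec D p) →
    Codes c j (v Vec.++ v′) → Codes c j v × Codes c (j + q) v′
  Codes-++ c j []      v′ cs = tt , subst (λ j → Codes c j v′) (sym (+-identityʳ j)) cs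
  Codes-++ c j {suc q} (x ∷ v) v′ (e , cs) = let cs₁ , cs₂ = Codes-++ c (suc j) v v′ cs in
    (e , cs₁) , subst (λ j → Codes c j v′) (sym (+-suc j q)) cs₂

  -- For the index of a vector of length `suc k`, division by `d ^ k` yields the code of the first
  -- coordinate and the remainder is the index of the rest.
  χ-match : ∀ c j {k} (v u w : Vec D k) → Codes c j v → χ c k j (index u) (index w) ≡ match v u w
  χ-match c j []      []      []      _        = refl
  χ-match c j {suc k} (x ∷ v) (a ∷ u) (b ∷ w) (e , cs) = begin
    is0 (nth 0ℤ table (index (a ∷ u) / d ^ k * d + index (b ∷ w) / d ^ k) ℤ.- c (+ j)) ℤ.* χ c k (suc j) (index (a ∷ u) % d ^ k) (index (b ∷ w) % d ^ k)
      ≡⟨ cong₂ (λ y z → is0 (nth 0ℤ table y ℤ.- c (+ j)) ℤ.* z)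
           (cong₂ (λ y z → y * d + z) ([m*n+o]/n (toℕ (to a)) (index-< u)) ([m*n+o]/n (toℕ (to b)) (index-< w)))
           (trans (cong₂ (χ c k (suc j)) ([m*n+o]%n (toℕ (to a)) (index-< u)) ([m*n+o]%n (toℕ (to b)) (index-< w))) (χ-match c (suc j) v u w cs)) ⟩
    is0 (nth 0ℤ table (toℕ (to a) * d + toℕ (to b)) ℤ.- c (+ j)) ℤ.* match v u w
      ≡⟨ cong₂ (λ y z → is0 (y ℤ.- z) ℤ.* match v u w) (nth-table a b) e ⟩
    is0 (code (f a b) ℤ.- code x) ℤ.* match v u w
      ≡⟨ cong (λ z → z ℤ.* match v u w) (is0-toℕ (to x) (to (f a b))) ⟩
    ⟦ does (x ≟ᴰ f a b) ⟧₀₁ ℤ.* match v u w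
      ≡⟨ ⟦∧⟧₀₁ (does (x ≟ᴰ f a b)) _ ⟨
    match (x ∷ v) (a ∷ u) (b ∷ w) ∎
    where instance _ = m^n≢0 d k

  -- Since q ≤ p, the arrays of the values of g and h are d ^ p × d ^ p matrices
  -- whose rows from d ^ q on vanish.
  ⊛-matrices : ∀ c {n q p} → q + p ≡ n → (g h : Vec D n → ℤ) (v : Vec D n) → q ≤ p → Codes c 0 v →
    let N = d ^ p in
    sum N (λ i → sum N (λ j →
      sum N (λ k → values g (i * N + k) ℤ.* χ c p q k j) ℤ.*
      sum N (λ k → χ c q 0 i k ℤ.* values h (k * N + j)))) ≡ (g ⊛ h) v
  ⊛-matrices c {q = q} {p} refl g h v q≤p cs with Vec.splitAt q v
  ... | v₁ , v₂ , refl = begin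
    sum N (λ i → sum N (λ j → X i j ℤ.* Y i j))
      -- From `d ^ q` on, a row number of G or H is not the index of a vector of length `q`, and
      -- `χ c q 0` has no meaning there. The zero rows of G remove these terms from the outer sum,
      -- and those of H from the sum in `Y`.
      ≡⟨ sum-truncate _ Q≤N (λ i Q≤i → sum-zero N (λ j → cong (λ z → z ℤ.* Y i j)
           (sum-zero N (λ k → cong (λ z → z ℤ.* χ c p q k j) (vanish g Q≤i k))))) ⟩
    sum (d ^ q) (λ i → sum N (λ j → X i j ℤ.* Y i j))
      ≡⟨ sum-index q _ ⟩
    sumOver (vectors q) (λ u → sum N (λ j → X (index u) j ℤ.* Y (index u) j))
      ≡⟨ sumOver-cong (vectors q) (λ u → sum-index p _) ⟩
    sumOver (vectors q) (λ u → sumOver (vectors p) (λ w′ → X (index u) (index w′) ℤ.* Y (index u) (index w′)))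
      ≡⟨ sumOver-cong (vectors q) (λ u → sumOver-cong (vectors p) (λ w′ → cong₂ ℤ._*_ (X-index u w′) (Y-index u w′))) ⟩
    _
      ≡⟨ ⊛-++ g h v₁ v₂ ⟨
    (g ⊛ h) (v₁ Vec.++ v₂) ∎
    where
    N = d ^ p
    Q≤N : d ^ q ≤ N
    Q≤N = ^-monoʳ-≤ d q≤p
    X Y : ℕ → ℕ → ℤ
    X i j = sum N (λ k → values g (i * N + k) ℤ.* χ c p q k j)
    Y i j = sum N (λ k → χ c q 0 i k ℤ.* values h (k * N + j))
    cs₁ = proj₁ (Codes-++ c 0 v₁ v₂ cs)
    cs₂ = proj₂ (Codes-++ c 0 v₁ v₂ cs)
    vanish : ∀ (g : Vec D (q + p) → ℤ) {i} → d ^ q ≤ i → ∀ k → values g (i * N + k) ≡ 0ℤ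
    vanish g {i} Q≤i k = values-≥ g (≤-trans (≤-reflexive (^-distribˡ-+-* d q p))
      (≤-trans (*-monoˡ-≤ N Q≤i) (m≤m+n (i * N) k)))
    X-index : ∀ u w′ → X (index u) (index w′) ≡ sumOver (vectors p) (λ u′ → g (u Vec.++ u′) ℤ.* match v₂ u′ w′)
    X-index u w′ = trans (sum-index p _) (sumOver-cong (vectors p) (λ u′ → cong₂ ℤ._*_
      (trans (cong (values g) (sym (index-++ u u′))) (values-index g (u Vec.++ u′))) (χ-match c q v₂ u′ w′ cs₂)))
    Y-index : ∀ u w′ → Y (index u) (index w′) ≡ sumOver (vectors q) (λ w → match v₁ u w ℤ.* h (w Vec.++ w′))
    Y-index u w′ = trans
      (sum-truncate _ Q≤N (λ k Q≤k → trans (cong (λ z → χ c q 0 (index u) k ℤ.* z) (vanish h Q≤k (index w′))) (ℤ.*-zeroʳ (χ c q 0 (index u) k))))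
      (trans (sum-index q _) (sumOver-cong (vectors q) (λ w → cong₂ ℤ._*_
        (χ-match c 0 v₁ u w cs₁) (trans (cong (values h) (sym (index-++ w w′))) (values-index h (w Vec.++ w′))))))

-- Programs and their cost

update-here : ∀ s a i x → (s [ a , i ↦ x ]) a i ≡ x
update-here s a i x rewrite dec-true (a ≟ a) refl | dec-true (i ℤ.≟ i) refl = refl

update-array : ∀ s {a b} i x j → a ≢ b → (s [ a , i ↦ x ]) b j ≡ s b j
update-array s {a} {b} i x j a≢b rewrite dec-false (a ≟ b) a≢b = refl

update-index : ∀ s a {i j} x → i ≢ j → (s [ a , i ↦ x ]) a j ≡ s a j
update-index s a {i} {j} x i≢j rewrite dec-true (a ≟ a) refl | dec-false (i ℤ.≟ j) i≢j = refl

retime : ∀ {c s s′ t t′} → t ≡ t′ → ⟨ c , s ⟩⇓⟨ s′ , t ⟩ → ⟨ c , s ⟩⇓⟨ s′ , t′ ⟩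
retime refl run = run

-- A Hoare triple for total correctness with a time bound, at a given initial state.
Run : Cmd → State → ℕ → (State → Set) → Set
Run c s T Q = Σ[ s′ ∈ State ] Σ[ t ∈ ℕ ] ⟨ c , s ⟩⇓⟨ s′ , t ⟩ × t ≤ T × Q s′

weaken : ∀ {c s T T′ Q Q′} → T ≤ T′ → (∀ {s′} → Q s′ → Q′ s′) → Run c s T Q → Run c s T′ Q′
weaken T≤T′ Q⇒Q′ (s′ , t , run , t≤T , q) = s′ , t , run , ≤-trans t≤T T≤T′ , Q⇒Q′ q

infixr 4 _>>=_

_>>=_ : ∀ {c₁ c₂ s T₁ T₂ Q₁ Q₂} → Run c₁ s T₁ Q₁ → (∀ {s′} → Q₁ s′ → Run c₂ s′ T₂ Q₂) →
  Run (c₁ ⨾ c₂) s (T₁ + T₂) Q₂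
(_ , _ , run₁ , t₁≤ , q₁) >>= k with k q₁
... | _ , _ , run₂ , t₂≤ , q₂ = _ , _ , ⇓seq run₁ run₂ , +-mono-≤ t₁≤ t₂≤ , q₂

exit : ∀ {e c s T} {Q : State → Set} → eval s e ℤ.≤ 0ℤ → testCost s e ≤ T → Q s → Run (while0< e c) s T Q
exit e≤0 t≤ q = _ , _ , ⇓exit e≤0 , t≤ , q

loop : ∀ {e c s T₀ T₁ T₂ Q₁ Q₂} → 0ℤ ℤ.< eval s e → testCost s e ≤ T₀ → Run c s T₁ Q₁ →
  (∀ {s′} → Q₁ s′ → Run (while0< e c) s′ T₂ Q₂) → Run (while0< e c) s (T₀ + T₁ + T₂) Q₂
loop 0<e t₀≤ (_ , _ , run₁ , t₁≤ , q₁) k with k q₁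
... | _ , _ , run₂ , t₂≤ , q₂ = _ , _ , ⇓loop 0<e run₁ run₂ , +-mono-≤ (+-mono-≤ t₀≤ t₁≤) t₂≤ , q₂

-- If all cells that e reads have length at most L, then the value of e has
-- length at most κ e * L and the evaluation costs at most κᵉ e * L.

κ κᵉ κᵗ : Exp → ℕ
κ (lit x)       = len x
κ (a [ e ])     = 1
κ (op o e₁ e₂)  = κ e₁ + κ e₂

κᵉ (lit x)      = len x
κᵉ (a [ e ])    = κᵉ e + (κ e + 1)
κᵉ (op o e₁ e₂) = κᵉ e₁ + κᵉ e₂ + (κ e₁ + κ e₂)

κᵗ e = κᵉ e + κ e

κʷ : Exp → Exp → ℕ
κʷ i e = κᵉ i + κᵉ e + (κ i + κ e)

-- Meant for sequences of writes, whose cost is linear in the length bound with a factor that can be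
-- read off the text. The value 0 elsewhere is a default and not a bound.
κᶜ : Cmd → ℕ
κᶜ (a [ i ]≔ e) = κʷ i e
κᶜ (c₁ ⨾ c₂)    = κᶜ c₁ + κᶜ c₂
κᶜ _            = 0

-- The bound concerns only the cells visited by the evaluation, so that single cells of the product
-- matrices can be read although nothing is known about the other cells of their arrays.
Reads : State → ℕ → Exp → Set
Reads s L (lit x)      = ⊤
Reads s L (a [ e ])    = Reads s L e × len (s a (eval s e)) ≤ L
Reads s L (op o e₁ e₂) = Reads s L e₁ × Reads s L e₂

+-*-≤ : ∀ {x y u} m n → x ≤ m * u → y ≤ n * u → x + y ≤ (m + n) * u
+-*-≤ {u = u} m n p q = ≤-trans (+-mono-≤ p q) (≤-reflexive (sym (*-distribʳ-+ u m n)))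

module _ {s : State} {L : ℕ} (1≤L : 1 ≤ L) where

  n≤n*L : ∀ n → n ≤ n * L
  n≤n*L n = subst (_≤ n * L) (*-identityʳ n) (*-monoʳ-≤ n 1≤L)

  len-eval : ∀ e → Reads s L e → len (eval s e) ≤ κ e * L
  len-eval (lit x)      _         = n≤n*L (len x)
  len-eval (a [ e ])    (_ , p)   = ≤-trans p (≤-reflexive (sym (*-identityˡ L)))
  len-eval (op o e₁ e₂) (p₁ , p₂) = ≤-trans (len-⟦⟧ o (eval s e₁) (eval s e₂))
    (+-*-≤ (κ e₁) (κ e₂) (len-eval e₁ p₁) (len-eval e₂ p₂))

  cost≤ : ∀ e → Reads s L e → cost s e ≤ κᵉ e * L
  cost≤ (lit x)      _         = n≤n*L (len x)
  cost≤ (a [ e ])    (p , q)   = +-*-≤ (κᵉ e) (κ e + 1) (cost≤ e p)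
    (+-*-≤ (κ e) 1 (len-eval e p) (≤-trans q (≤-reflexive (sym (*-identityˡ L)))))
  cost≤ (op o e₁ e₂) (p₁ , p₂) = +-*-≤ (κᵉ e₁ + κᵉ e₂) (κ e₁ + κ e₂)
    (+-*-≤ (κᵉ e₁) (κᵉ e₂) (cost≤ e₁ p₁) (cost≤ e₂ p₂))
    (+-*-≤ (κ e₁) (κ e₂) (len-eval e₁ p₁) (len-eval e₂ p₂))

  testCost≤ : ∀ e → Reads s L e → testCost s e ≤ κᵗ e * L
  testCost≤ e p = +-*-≤ (κᵉ e) (κ e) (cost≤ e p) (len-eval e p)

  writeCost≤ : ∀ i e → Reads s L i → Reads s L e → writeCost s i e ≤ κʷ i e * L
  writeCost≤ i e p q = +-*-≤ (κᵉ i + κᵉ e) (κ i + κ e) (+-*-≤ (κᵉ i) (κᵉ e) (cost≤ i p) (cost≤ e q))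
    (+-*-≤ (κ i) (κ e) (len-eval i p) (len-eval e q))

-- The matrix multiplication programs work on the arrays from 6 on.

Own : Exp → Set
Own (lit x)      = ⊤
Own (a [ e ])    = T (a <ᵇ 6) × Own e
Own (op o e₁ e₂) = Own e₁ × Own e₂

module Bounded (L : ℕ) (1≤L : 1 ≤ L) where

  record Short (z : ℤ) : Set where
    constructor within
    field len≤ : len z ≤ L

  record Small (s : State) : Set where
    constructor cells
    field cell : ∀ a → T (a <ᵇ 6) → ∀ i → Short (s a i)

  open Short public
  open Small public

  reads : ∀ {s} → Small s → ∀ e → Own e → Reads s L e
  reads small (lit x)      _         = tt
  reads small (a [ e ])    (p , q)   = reads small e q , len≤ (cell small a p _)
  reads small (op o e₁ e₂) (p₁ , p₂) = reads small e₁ p₁ , reads small e₂ p₂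

  small-update : ∀ {s} a i {x} → Small s → Short x → Small (s [ a , i ↦ x ])
  small-update {s} a i {x} small x≤ = cells updated
    where
    updated : ∀ b → T (b <ᵇ 6) → ∀ j → Short ((s [ a , i ↦ x ]) b j)
    updated b p j with does (a ≟ b) ∧ does (i ℤ.≟ j)
    ... | true  = x≤
    ... | false = cell small b p j

  last : ∀ {s a i e Q} → Small s → {Own i} → {Own e} → Short (eval s e) →
    (Small (s [ a , eval s i ↦ eval s e ]) → Q (s [ a , eval s i ↦ eval s e ])) →
    Run (a [ i ]≔ e) s (κᶜ (a [ i ]≔ e) * L) Q
  last {s} {a} {i} {e} small {p} {q} e≤ k = _ , _ , ⇓write ,
    writeCost≤ 1≤L i e (reads small i p) (reads small e q) , k (small-update a (eval s i) small e≤)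

  -- Symbolic execution of a block of writes. Each write only owes a proof that its value is short;
  -- the state passed on is explicit, so later cell contents are found by computation.
  step : ∀ {s a i e c Q} → Small s → {Own i} → {Own e} → Short (eval s e) →
    (Small (s [ a , eval s i ↦ eval s e ]) → Run c (s [ a , eval s i ↦ eval s e ]) (κᶜ c * L) Q) →
    Run (a [ i ]≔ e ⨾ c) s (κᶜ (a [ i ]≔ e ⨾ c) * L) Q
  step {s} {a} {i} {e} {c} small {p} {q} e≤ k with k (small-update a (eval s i) small e≤)
  ... | _ , _ , run , t≤ , post = _ , _ , ⇓seq ⇓write run ,
    ≤-trans (+-mono-≤ (writeCost≤ 1≤L i e (reads small i p) (reads small e q)) t≤)
      (≤-reflexive (sym (*-distribʳ-+ L (κʷ i e) (κᶜ c)))) , post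

-- Relocating a program to other arrays

renameᵉ : (ℕ → ℕ) → Exp → Exp
renameᵉ ρ (lit x)      = lit x
renameᵉ ρ (a [ e ])    = ρ a [ renameᵉ ρ e ]
renameᵉ ρ (op o e₁ e₂) = op o (renameᵉ ρ e₁) (renameᵉ ρ e₂)

rename : (ℕ → ℕ) → Cmd → Cmd
rename ρ skip           = skip
rename ρ (a [ i ]≔ e)   = ρ a [ renameᵉ ρ i ]≔ renameᵉ ρ e
rename ρ (c₁ ⨾ c₂)      = rename ρ c₁ ⨾ rename ρ c₂
rename ρ (if0< e c₁ c₂) = if0< (renameᵉ ρ e) (rename ρ c₁) (rename ρ c₂)
rename ρ (while0< e c)  = while0< (renameᵉ ρ e) (rename ρ c)

module Renaming (ρ : ℕ → ℕ) (ρ-injective : ∀ {a b} → ρ a ≡ ρ b → a ≡ b) where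

  infix 4 _≈ρ_

  record _≈ρ_ (S s : State) : Set where
    constructor agree
    field at : ∀ a i → S (ρ a) i ≡ s a i

  open _≈ρ_ public

  eval-rename : ∀ {S s} → S ≈ρ s → ∀ e → eval S (renameᵉ ρ e) ≡ eval s e
  eval-rename S≈s (lit x)      = refl
  eval-rename {S} {s} S≈s (a [ e ]) = trans (cong (S (ρ a)) (eval-rename S≈s e)) (at S≈s a (eval s e))
  eval-rename S≈s (op o e₁ e₂) = cong₂ ⟦ o ⟧ (eval-rename S≈s e₁) (eval-rename S≈s e₂)

  cost-rename : ∀ {S s} → S ≈ρ s → ∀ e → cost S (renameᵉ ρ e) ≡ cost s e
  cost-rename S≈s (lit x)      = refl
  cost-rename {s = s} S≈s (a [ e ])
    rewrite cost-rename S≈s e | eval-rename S≈s e | at S≈s a (eval s e) = refl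
  cost-rename S≈s (op o e₁ e₂)
    rewrite cost-rename S≈s e₁ | cost-rename S≈s e₂ | eval-rename S≈s e₁ | eval-rename S≈s e₂ = refl

  testCost-rename : ∀ {S s} → S ≈ρ s → ∀ e → testCost S (renameᵉ ρ e) ≡ testCost s e
  testCost-rename S≈s e = cong₂ _+_ (cost-rename S≈s e) (cong len (eval-rename S≈s e))

  writeCost-rename : ∀ {S s} → S ≈ρ s → ∀ i e → writeCost S (renameᵉ ρ i) (renameᵉ ρ e) ≡ writeCost s i e
  writeCost-rename S≈s i e
    rewrite cost-rename S≈s i | cost-rename S≈s e | eval-rename S≈s i | eval-rename S≈s e = refl

  update-rename : ∀ {S s} → S ≈ρ s → ∀ a {i j x y} → i ≡ j → x ≡ y → S [ ρ a , i ↦ x ] ≈ρ s [ a , j ↦ y ]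
  update-rename {S} {s} S≈s a {i} {x = x} refl refl = agree updated
    where
    updated : ∀ b k → (S [ ρ a , i ↦ x ]) (ρ b) k ≡ (s [ a , i ↦ x ]) b k
    updated b k = cases (a ≟ b) (i ℤ.≟ k)
      where
      cases : Dec (a ≡ b) → Dec (i ≡ k) → (S [ ρ a , i ↦ x ]) (ρ b) k ≡ (s [ a , i ↦ x ]) b k
      cases (no a≢b)   _          = trans (update-array S i x k (λ e → a≢b (ρ-injective e)))
        (trans (at S≈s b k) (sym (update-array s i x k a≢b)))
      cases (yes refl) (yes refl) = trans (update-here S (ρ a) i x) (sym (update-here s a i x))
      cases (yes refl) (no i≢k)   = trans (update-index S (ρ a) x i≢k)
        (trans (at S≈s a k) (sym (update-index s a x i≢k)))

  Outside : ℕ → Set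
  Outside b = ∀ a → ρ a ≢ b

  -- The semantics uses array names only by comparing them, and charges for indices and values but
  -- not for names. An injective renaming therefore preserves each step and its exact cost, whatever
  -- the arrays outside the image hold.
  simulate : ∀ {c s s′ t S} → ⟨ c , s ⟩⇓⟨ s′ , t ⟩ → S ≈ρ s →
    Σ[ S′ ∈ State ] ⟨ rename ρ c , S ⟩⇓⟨ S′ , t ⟩ × S′ ≈ρ s′ × (∀ b → Outside b → ∀ i → S′ b i ≡ S b i)
  simulate ⇓skip S≈s = _ , ⇓skip , S≈s , λ _ _ _ → refl
  simulate {S = S} (⇓write {a} {i} {e}) S≈s = _ ,
    retime (writeCost-rename S≈s i e) ⇓write ,
    update-rename S≈s a (eval-rename S≈s i) (eval-rename S≈s e) ,
    λ b out j → update-array S (eval S (renameᵉ ρ i)) _ j (out a)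
  simulate (⇓seq r₁ r₂) S≈s =
    let _ , R₁ , S₁≈ , out₁ = simulate r₁ S≈s
        _ , R₂ , S₂≈ , out₂ = simulate r₂ S₁≈
    in _ , ⇓seq R₁ R₂ , S₂≈ , λ b out i → trans (out₂ b out i) (out₁ b out i)
  simulate (⇓then {e} {t = t} 0<e r) S≈s =
    let _ , R , S′≈ , out = simulate r S≈s
    in _ , retime (cong (_+ t) (testCost-rename S≈s e))
             (⇓then (subst (0ℤ ℤ.<_) (sym (eval-rename S≈s e)) 0<e) R) , S′≈ , out
  simulate (⇓else {e} {t = t} e≤0 r) S≈s =
    let _ , R , S′≈ , out = simulate r S≈s
    in _ , retime (cong (_+ t) (testCost-rename S≈s e))
             (⇓else (subst (ℤ._≤ 0ℤ) (sym (eval-rename S≈s e)) e≤0) R) , S′≈ , out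
  simulate (⇓loop {e} {t₁ = t₁} {t₂} 0<e r₁ r₂) S≈s =
    let _ , R₁ , S₁≈ , out₁ = simulate r₁ S≈s
        _ , R₂ , S₂≈ , out₂ = simulate r₂ S₁≈
    in _ , retime (cong (λ T → T + t₁ + t₂) (testCost-rename S≈s e))
             (⇓loop (subst (0ℤ ℤ.<_) (sym (eval-rename S≈s e)) 0<e) R₁ R₂) ,
       S₂≈ , λ b out i → trans (out₂ b out i) (out₁ b out i)
  simulate (⇓exit {e} e≤0) S≈s = _ ,
    retime (testCost-rename S≈s e)
      (⇓exit (subst (ℤ._≤ 0ℤ) (sym (eval-rename S≈s e)) e≤0)) , S≈s , λ _ _ _ → refl

infixl 21 _⊞_ _⊟_
infixl 22 _⊠_ _⊘_

_⊞_ _⊟_ _⊠_ _⊘_ : Exp → Exp → Exp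
_⊞_ = op add
_⊟_ = op sub
_⊠_ = op mul
_⊘_ = op div

# : ℕ → Exp
# n = lit (+ n)

zero? : Exp → Exp
zero? e = # 1 ⊘ (# 1 ⊞ e ⊠ e)

-- Reading a constant list by arithmetic alone: each entry is multiplied by the indicator of its
-- position. For `table` the size of the expression depends on f only, so it costs a constant
-- factor.
select : List ℤ → Exp → Exp
select []       e = # 0
select (x ∷ xs) e = zero? e ⊠ lit x ⊞ select xs (e ⊟ # 1)

own-select : ∀ xs e → Own e → Own (select xs e)
own-select []       e o = tt
own-select (x ∷ xs) e o = (((tt , tt , o , o)) , tt) , own-select xs (e ⊟ # 1) (o , tt)

-- Subtracting 1 keeps a negative index negative, so no test succeeds. This disposes of the entries
-- behind a hit.
eval-select-neg : ∀ s xs e {i} → eval s e ≡ -[1+ i ] → eval s (select xs e) ≡ 0ℤ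
eval-select-neg s []       e     eq = refl
eval-select-neg s (x ∷ xs) e {i} eq
  rewrite eval-select-neg s xs (e ⊟ # 1) (cong (λ z → z ℤ.- 1ℤ) eq)
        | cong is0 eq | is0-≢ -[1+ i ] (λ ()) = refl

eval-select : ∀ s xs e {i} → eval s e ≡ + i → eval s (select xs e) ≡ nth 0ℤ xs i
eval-select s []       e         eq = refl
eval-select s (x ∷ xs) e {zero}  eq
  rewrite eval-select-neg s xs (e ⊟ # 1) {0} (cong (λ z → z ℤ.- 1ℤ) eq) | eq = 
    trans (ℤ.+-identityʳ _) (ℤ.*-identityˡ x)
eval-select s (x ∷ xs) e {suc i} eq
  rewrite eval-select s xs (e ⊟ # 1) {i} (cong (λ z → z ℤ.- 1ℤ) eq)
        | cong is0 eq | is0-≢ (+ suc i) (λ ()) = ℤ.+-identityˡ _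

-- The program for the query problem

positive : ∀ {z n} → z ≡ + suc n → 0ℤ ℤ.< z
positive eq = subst (0ℤ ℤ.<_) (sym eq) (ℤ.+<+ (s≤s z≤n))

null : ∀ {z} → z ≡ 0ℤ → z ℤ.≤ 0ℤ
null = ℤ.≤-reflexive

ScratchOnly : State → State → Set
ScratchOnly s s′ = ∀ b i → 5 ≢ b → s′ b i ≡ s b i

-- The invariant of a loop that fills an array downwards: the cells below `k` are still open.
-- Negative cells are included because `initial` prescribes them too.
record Filled (k : ℕ) (X : ℕ → ℤ) (array : ℤ → ℤ) : Set where
  field
    at≥ : ∀ j → k ≤ j → array (+ j) ≡ X j
    neg : ∀ j → array -[1+ j ] ≡ 0ℤ

open Filled

filled-cong : ∀ {k X A B} → (∀ i → B i ≡ A i) → Filled k X A → Filled k X B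
filled-cong eq F = record { at≥ = λ j k≤j → trans (eq (+ j)) (at≥ F j k≤j) ; neg = λ j → trans (eq -[1+ j ]) (neg F j) }

filled-update : ∀ {s b k X i v} → i ≡ + k → v ≡ X k → Filled (suc k) X (s b) → Filled k X ((s [ b , i ↦ v ]) b)
filled-update {s} {b} {k} {X} refl refl F = record
  { at≥ = λ j k≤j → cases j k≤j (k ≟ j)
  ; neg = λ j → trans (update-index s b {+ k} (X k) (λ ())) (neg F j) }
  where
  cases : ∀ j → k ≤ j → Dec (k ≡ j) → (s [ b , + k ↦ X k ]) b (+ j) ≡ X j
  cases j k≤j (yes refl) = update-here s b (+ k) (X k)
  cases j k≤j (no k≢j)   = trans (update-index s b (X k) (λ e → k≢j (ℤ.+-injective e))) (at≥ F j (≤∧≢⇒< k≤j k≢j))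

-- Which arrays the multiplication program uses is unknown, so two interleaved copies of the whole
-- memory are laid out above the six own arrays. The inputs of the first product are in arrays 6, 8,
-- 10, those of the second in 7, 9, 11; from 12 on all must be 0.
even odd : ℕ → ℕ
even a = 6 + a * 2
odd  a = 7 + a * 2

even-injective : ∀ {a b} → even a ≡ even b → a ≡ b
even-injective {a} {b} eq = *-cancelʳ-≡ a b 2 (+-cancelˡ-≡ 6 (a * 2) (b * 2) eq)

odd-injective : ∀ {a b} → odd a ≡ odd b → a ≡ b
odd-injective {a} {b} eq = *-cancelʳ-≡ a b 2 (+-cancelˡ-≡ 7 (a * 2) (b * 2) eq)

even-odd-disjoint : ∀ a b → even a ≢ odd b
even-odd-disjoint a b eq = even≢odd a b (trans (*-comm 2 a)
  (trans (+-cancelˡ-≡ 6 (a * 2) (suc (b * 2)) eq) (cong suc (*-comm b 2))))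

module Even = Renaming even even-injective
module Odd = Renaming odd odd-injective

own-outside-even : ∀ b → T (b <ᵇ 6) → Even.Outside b
own-outside-even b b<6 a refl = <⇒≱ (<ᵇ⇒< b 6 b<6) (m≤m+n 6 (a * 2))

own-outside-odd : ∀ b → T (b <ᵇ 6) → Odd.Outside b
own-outside-odd b b<6 a refl = <⇒≱ (<ᵇ⇒< b 6 b<6) (≤-trans (m≤m+n 6 (a * 2)) (n≤1+n _))

outputs-nth : ∀ {s ys} → Outputs s ys → ∀ {i} → i < length ys → s 0 (+ i) ≡ nth 0ℤ ys i
outputs-nth {s} {ys} outputs i< = trans (cong (λ j → s 0 (+ j)) (sym (Fin.toℕ-fromℕ< i<)))
  (trans (outputs (Fin.fromℕ< i<)) (trans (sym (nth-lookup ys (Fin.fromℕ< i<))) (cong (nth 0ℤ ys) (Fin.toℕ-fromℕ< i<))))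

module Programs {D : Set} {d : ℕ} .{{d≢0 : NonZero d}} (2≤d : 2 ≤ d) (enum : D ↔ Fin d) (f : D → D → D) where

  open FQuery enum f
  open Query enum f

  -- Arrays 0 to 3 hold the input, and array 0 the output; array 4 holds the
  -- scalars of the outer loops, array 5 those of the digit loop.

  counter size half x y power position flag : Exp
  counter  = 4 [ # 0 ]
  size     = 4 [ # 1 ]
  half     = 4 [ # 2 ]
  x        = 5 [ # 0 ]
  y        = 5 [ # 1 ]
  power    = 5 [ # 2 ]
  position = 5 [ # 3 ]
  flag   = 5 [ # 4 ]

  matchExp : Exp
  matchExp = zero? (select table ((x ⊘ power) ⊠ # d ⊞ y ⊘ power) ⊟ 3 [ position ])

  own-matchExp : Own matchExp
  own-matchExp = let own = own-select table ((x ⊘ power) ⊠ # d ⊞ y ⊘ power) _ in tt , (tt , (own , _) , (own , _))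

  -- With `k` digits left, `power` is d ^ `k`. It is divided by d first, so that `x ⊘ power` becomes
  -- the leading digit; the loop ends when `power` is 1.
  digit digits : Cmd
  digit =
      5 [ # 2 ]≔ power ⊘ # d
    ⨾ 5 [ # 4 ]≔ flag ⊠ matchExp
    ⨾ 5 [ # 0 ]≔ x ⊟ (x ⊘ power) ⊠ power
    ⨾ 5 [ # 1 ]≔ y ⊟ (y ⊘ power) ⊠ power
    ⨾ 5 [ # 3 ]≔ position ⊞ # 1
  digits = while0< (power ⊟ # 1) digit

  digitsTime : ℕ
  digitsTime = κᵗ (power ⊟ # 1) + κᶜ digit

  power-step setup₁ setup₂ setup : Cmd
  power-step =
      4 [ # 0 ]≔ counter ⊟ # 1
    ⨾ 4 [ # 2 ]≔ half ⊠ # d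
  setup₁ =
      4 [ # 0 ]≔ 0 [ # 0 ] ⊘ # 2
    ⨾ 4 [ # 2 ]≔ # 1
  setup₂ =
      -- The factor 1 + (n mod 2) (d - 1) is 1 for even and d for odd n, so `size` becomes d ^
      -- ⌈n/2⌉.
      4 [ # 1 ]≔ half ⊠ (# 1 ⊞ (0 [ # 0 ] ⊟ (0 [ # 0 ] ⊘ # 2) ⊠ # 2) ⊠ # (d ∸ 1))
    ⨾ 6 [ # 0 ]≔ size
    ⨾ 7 [ # 0 ]≔ size
    ⨾ 4 [ # 0 ]≔ size ⊠ size
  setup = setup₁ ⨾ while0< counter power-step ⨾ setup₂

  prepare₁ prepare₂ prepare store fill : Cmd
  prepare₁ =
      4 [ # 0 ]≔ counter ⊟ # 1
    ⨾ 5 [ # 0 ]≔ counter ⊘ size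
    ⨾ 5 [ # 1 ]≔ counter ⊟ (counter ⊘ size) ⊠ size
    ⨾ 5 [ # 2 ]≔ half
    ⨾ 5 [ # 3 ]≔ # 0
    ⨾ 5 [ # 4 ]≔ # 1
  -- `position` is not reset: the first digit loop has left it at the start of the second half of v.
  prepare₂ =
      4 [ # 3 ]≔ flag
    ⨾ 5 [ # 0 ]≔ counter ⊘ size
    ⨾ 5 [ # 1 ]≔ counter ⊟ (counter ⊘ size) ⊠ size
    ⨾ 5 [ # 2 ]≔ size
    ⨾ 5 [ # 4 ]≔ # 1
  prepare = prepare₁ ⨾ digits ⨾ prepare₂ ⨾ digits
  store =
      9 [ counter ]≔ 4 [ # 3 ]
    ⨾ 10 [ counter ]≔ flag
    -- Past the end of a value list the cells read are 0, which produces the padding.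
    ⨾ 8 [ counter ]≔ 1 [ counter ]
    ⨾ 11 [ counter ]≔ 2 [ counter ]
  fill = while0< counter (prepare ⨾ store)

  reset accumulate-step accumulate : Cmd
  reset =
      0 [ # 0 ]≔ # 0
    ⨾ 4 [ # 0 ]≔ size ⊠ size
  accumulate-step =
      4 [ # 0 ]≔ counter ⊟ # 1
    ⨾ 0 [ # 0 ]≔ 0 [ # 0 ] ⊞ 6 [ counter ] ⊠ 7 [ counter ]
  accumulate = while0< counter accumulate-step

  query : Cmd → Cmd
  query multiply = setup ⨾ fill ⨾ rename even multiply ⨾ rename odd multiply ⨾ reset ⨾ accumulate

  powerTime : ℕ
  powerTime = κᵗ counter + κᶜ power-step

  accumulateTime : ℕ
  accumulateTime = κᵗ counter + κᶜ accumulate-step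

  -- The summands of the two loops over all entries are doubled because the final test makes the
  -- number of rounds charged N² + 1 ≤ 2 N².
  setupFactor fillFactor ownFactor : ℕ
  setupFactor = κᶜ setup₁ + (powerTime + κᶜ setup₂)
  fillFactor  = κᵗ counter + (κᶜ prepare₁ + (digitsTime + (κᶜ prepare₂ + digitsTime)) + κᶜ store)
  ownFactor   = setupFactor + (fillFactor + fillFactor + (κᶜ reset + (accumulateTime + accumulateTime)))

  -- Correctness and running time of the phases

  module Correctness (V : ℕ) (1≤V : 1 ≤ V) where

    L : ℕ
    L = bits V

    open Bounded L (1≤bits V) public

    short : ∀ {z i} → z ≡ + i → i ≤ V → Short z
    short refl i≤V = within (bits-mono i≤V)

    short-≤1 : ∀ {z} → ∣ z ∣ ≤ 1 → Short z
    short-≤1 z≤1 = within (bits-mono (≤-trans z≤1 1≤V))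

    record Digits (s : State) (c : ℤ → ℤ) (k i j l : ℕ) (r : ℤ) : Set where
      field
        small    : Small s
        x≡       : s 5 (+ 0) ≡ + i
        y≡       : s 5 (+ 1) ≡ + j
        power≡   : s 5 (+ 2) ≡ + (d ^ k)
        position≡ : s 5 (+ 3) ≡ + l
        flag≡  : s 5 (+ 4) ≡ r
        code≡    : ∀ i → s 3 i ≡ c i
        x≤       : i ≤ V
        y≤       : j ≤ V
        power≤   : d ^ k ≤ V
        position≤ : l + k ≤ V
        flag≤  : ∣ r ∣ ≤ 1

    -- `χ` is defined by recursion along the same leading digits as the loop, so the flag collects
    -- its factors one at a time. This also covers the row numbers that are too large to index a
    -- vector of length `k`.
    digits-run : ∀ k {s c i j l r} → Digits s c k i j l r →
      Run digits s (suc k * (digitsTime * L)) λ s′ →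
        Small s′ × s′ 5 (+ 4) ≡ r ℤ.* χ c k l i j × s′ 5 (+ 3) ≡ + (l + k) × ScratchOnly s s′
    digits-run zero {s} {l = l} {r} pre = exit
      (null (cong (λ z → z ℤ.- 1ℤ) power≡))
      (≤-trans (testCost≤ {s} (1≤bits V) (power ⊟ # 1) (reads small (power ⊟ # 1) _))
        (≤-trans (*-monoˡ-≤ L (m≤m+n (κᵗ (power ⊟ # 1)) (κᶜ digit))) (≤-reflexive (sym (+-identityʳ _)))))
      (small , trans flag≡ (sym (ℤ.*-identityʳ r)) , trans position≡ (cong +_ (sym (+-identityʳ l))) , λ _ _ _ → refl)
      where open Digits pre
    digits-run (suc k) {s} {c} {i} {j} {l} {r} pre = weaken time id (loop {Q₁ = λ s′ → Digits s′ c k (i % d ^ k) (j % d ^ k) (suc l) r″ × ScratchOnly s s′}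
      (positive (trans (cong (λ z → z ℤ.- 1ℤ) power≡) pred-power))
      (testCost≤ {s} (1≤bits V) (power ⊟ # 1) (reads small (power ⊟ # 1) _))
      (step small (short P≡ (≤-trans P≤ power≤)) λ small₁ →
       step small₁ {_} {_ , own-matchExp} (short-≤1 (subst (λ z → ∣ z ∣ ≤ 1) (sym r≡) r≤)) λ small₂ →
       step small₂ (short i≡ (≤-trans (m%n≤m i (d ^ k)) x≤)) λ small₃ →
       step small₃ (short j≡ (≤-trans (m%n≤m j (d ^ k)) y≤)) λ small₄ →
       last small₄ (short l≡ l≤) λ small₅ → record
         { small = small₅ ; x≡ = i≡ ; y≡ = j≡ ; power≡ = P≡ ; position≡ = l≡ ; flag≡ = r≡ ; code≡ = code≡
         ; x≤ = ≤-trans (m%n≤m i (d ^ k)) x≤ ; y≤ = ≤-trans (m%n≤m j (d ^ k)) y≤ ; power≤ = ≤-trans P≤ power≤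
         ; position≤ = subst (_≤ V) (+-suc l k) position≤ ; flag≤ = r≤ } , frame)
      (λ (pre′ , frame) → weaken ≤-refl
        (λ (small′ , r′ , l′ , frame′) → small′ , trans r′ (ℤ.*-assoc r _ _) , trans l′ (cong +_ (sym (+-suc l k))) ,
          λ b i 5≢b → trans (frame′ b i 5≢b) (frame b i 5≢b)) (digits-run k pre′)))
      where
      open Digits pre
      instance
        _ = m^n≢0 d k
      s₁ = s [ 5 , + 2 ↦ eval s (power ⊘ # d) ]
      s₂ = s₁ [ 5 , + 4 ↦ eval s₁ (flag ⊠ matchExp) ]
      s₃ = s₂ [ 5 , + 0 ↦ eval s₂ (x ⊟ (x ⊘ power) ⊠ power) ]
      s₄ = s₃ [ 5 , + 1 ↦ eval s₃ (y ⊟ (y ⊘ power) ⊠ power) ]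
      s₅ = s₄ [ 5 , + 3 ↦ eval s₄ (position ⊞ # 1) ]
      r″ = r ℤ.* is0 (nth 0ℤ table (i / d ^ k * d + j / d ^ k) ℤ.- c (+ l))
      2≤power : 2 ≤ d ^ suc k
      2≤power = ≤-trans 2≤d (m≤m*n d (d ^ k))
      pred-power : + (d ^ suc k) ℤ.- 1ℤ ≡ + suc (d ^ suc k ∸ 2)
      pred-power with d ^ suc k | 2≤power
      ... | suc (suc _) | _      = refl
      ... | suc zero    | s≤s ()
      m*n/m≡n : ∀ n → d * n / d ≡ n
      m*n/m≡n n = trans (cong (_/ d) (*-comm d n)) (m*n/n≡m n d)
      P≡ : eval s (power ⊘ # d) ≡ + (d ^ k)
      P≡ = trans (cong (λ z → ⟦ div ⟧ z (+ d)) power≡) (trans (div-ℕ (d * d ^ k) d) (cong +_ (m*n/m≡n (d ^ k))))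
      P≤ : d ^ k ≤ d ^ suc k
      P≤ = m≤n*m (d ^ k) d
      r≤ : ∣ r″ ∣ ≤ 1
      r≤ = ≤-trans (≤-reflexive (ℤ.∣i*j∣≡∣i∣*∣j∣ r _)) (*-mono-≤ flag≤ (∣is0∣≤1 (nth 0ℤ table (i / d ^ k * d + j / d ^ k) ℤ.- c (+ l))))
      r≡ : eval s₁ (flag ⊠ matchExp) ≡ r″
      r≡ = cong₂ ℤ._*_ flag≡ (cong is0 (cong₂ ℤ._-_
        (eval-select s₁ table ((x ⊘ power) ⊠ # d ⊞ y ⊘ power) entry)
        (trans (cong (s 3) position≡) (code≡ (+ l)))))
        where
        entry : eval s₁ ((x ⊘ power) ⊠ # d ⊞ y ⊘ power) ≡ + (i / d ^ k * d + j / d ^ k)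
        entry = cong₂ (λ a b → a ℤ.+ b)
          (trans (cong (λ z → z ℤ.* + d) (trans (cong₂ ⟦ div ⟧ x≡ P≡) (div-ℕ i (d ^ k)))) (sym (ℤ.pos-* (i / d ^ k) d)))
          (trans (cong₂ ⟦ div ⟧ y≡ P≡) (div-ℕ j (d ^ k)))
      i≡ : eval s₂ (x ⊟ (x ⊘ power) ⊠ power) ≡ + (i % d ^ k)
      i≡ = trans (cong₂ (λ a b → a ℤ.- ⟦ div ⟧ a b ℤ.* b) x≡ P≡) (mod-ℕ i (d ^ k))
      j≡ : eval s₃ (y ⊟ (y ⊘ power) ⊠ power) ≡ + (j % d ^ k)
      j≡ = trans (cong₂ (λ a b → a ℤ.- ⟦ div ⟧ a b ℤ.* b) y≡ P≡) (mod-ℕ j (d ^ k))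
      l≡ : eval s₄ (position ⊞ # 1) ≡ + suc l
      l≡ = trans (cong (λ z → z ℤ.+ 1ℤ) position≡) (cong +_ (+-comm l 1))
      l≤ : suc l ≤ V
      l≤ = ≤-trans (s≤s (m≤m+n l k)) (subst (_≤ V) (+-suc l k) position≤)
      frame : ScratchOnly s s₅
      frame b i 5≢b rewrite dec-false (5 ≟ b) 5≢b = refl
      time : κᵗ (power ⊟ # 1) * L + κᶜ digit * L + suc k * (digitsTime * L) ≤ suc (suc k) * (digitsTime * L)
      time = ≤-reflexive (cong (_+ suc k * (digitsTime * L)) (sym (*-distribʳ-+ L (κᵗ (power ⊟ # 1)) (κᶜ digit))))

    decrement : ∀ {s k} → s 4 (+ 0) ≡ + suc k → eval s (counter ⊟ # 1) ≡ + k
    decrement eq = cong (λ z → z ℤ.- 1ℤ) eq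

    power-run : ∀ k {s} m → Small s → s 4 (+ 0) ≡ + k → s 4 (+ 2) ≡ + (d ^ m) → k ≤ V → d ^ (k + m) ≤ V →
      Run (while0< counter power-step) s (suc k * (powerTime * L)) λ s′ →
        Small s′ × s′ 4 (+ 2) ≡ + (d ^ (k + m)) × (∀ b i → 4 ≢ b → s′ b i ≡ s b i)
    power-run zero {s} m small k≡ P≡ _ _ = exit (null k≡)
      (≤-trans (testCost≤ {s} (1≤bits V) counter (reads small counter _))
        (≤-trans (*-monoˡ-≤ L (m≤m+n (κᵗ counter) (κᶜ power-step))) (≤-reflexive (sym (+-identityʳ _)))))
      (small , P≡ , λ _ _ _ → refl)
    power-run (suc k) {s} m small k≡ P≡ k≤ d^≤ = weaken time id (loop
      {Q₁ = λ s′ → Small s′ × s′ 4 (+ 0) ≡ + k × s′ 4 (+ 2) ≡ + (d ^ suc m) × (∀ b i → 4 ≢ b → s′ b i ≡ s b i)}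
      (positive k≡)
      (testCost≤ {s} (1≤bits V) counter (reads small counter _))
      (step small (short (decrement {s} k≡) (≤-trans (n≤1+n k) k≤)) λ small₁ →
       last small₁ (short P′≡ (≤-trans (^-monoʳ-≤ d (s≤s (m≤n+m m k))) d^≤)) λ small₂ →
         small₂ , decrement {s} k≡ , P′≡ , frame)
      (λ (small′ , k′≡ , P″≡ , frame) → weaken ≤-refl
        (λ (small″ , P‴≡ , frame′) → small″ , trans P‴≡ (cong (λ z → + (d ^ z)) (+-suc k m)) ,
          λ b i 4≢b → trans (frame′ b i 4≢b) (frame b i 4≢b))
        (power-run k (suc m) small′ k′≡ P″≡ (≤-trans (n≤1+n k) k≤) (subst (λ z → d ^ z ≤ V) (sym (+-suc k m)) d^≤))))
      where
      P′≡ : s 4 (+ 2) ℤ.* + d ≡ + (d ^ suc m)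
      P′≡ = trans (cong (λ z → z ℤ.* + d) P≡) (trans (sym (ℤ.pos-* (d ^ m) d)) (cong +_ (*-comm (d ^ m) d)))
      s₁ = s [ 4 , + 0 ↦ eval s (counter ⊟ # 1) ]
      s₂ = s₁ [ 4 , + 2 ↦ eval s₁ (half ⊠ # d) ]
      frame : ∀ b i → 4 ≢ b → s₂ b i ≡ s b i
      frame b i 4≢b rewrite dec-false (4 ≟ b) 4≢b = refl
      time : κᵗ counter * L + κᶜ power-step * L + suc k * (powerTime * L) ≤ suc (suc k) * (powerTime * L)
      time = ≤-reflexive (cong (_+ suc k * (powerTime * L)) (sym (*-distribʳ-+ L (κᵗ counter) (κᶜ power-step))))

    -- The bound on `∣ r ∣ + k * K` reserves room for the `k` products still to come, which keeps
    -- every partial sum short. Arrays 6 and 7 lie outside `Small`, so the cost of reading them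
    -- rests on the bounds for `X` and `Y`.
    accumulate-run : ∀ k {s} (X Y : ℕ → ℤ) K r → Small s → s 4 (+ 0) ≡ + k → k ≤ V → s 0 (+ 0) ≡ r →
      (∀ i → i < k → s 6 (+ i) ≡ X i × s 7 (+ i) ≡ Y i) →
      (∀ i → ∣ X i ∣ ≤ V × ∣ Y i ∣ ≤ V × ∣ X i ℤ.* Y i ∣ ≤ K) → ∣ r ∣ + k * K ≤ V →
      Run accumulate s (suc k * (accumulateTime * L)) λ s′ → s′ 0 (+ 0) ≡ r ℤ.+ sum k (λ i → X i ℤ.* Y i)
    accumulate-run zero {s} X Y K r small k≡ _ r≡ _ _ _ = exit (null k≡)
      (≤-trans (testCost≤ {s} (1≤bits V) counter (reads small counter _))
        (≤-trans (*-monoˡ-≤ L (m≤m+n (κᵗ counter) (κᶜ accumulate-step))) (≤-reflexive (sym (+-identityʳ _)))))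
      (trans r≡ (sym (ℤ.+-identityʳ r)))
    accumulate-run (suc k) {s} X Y K r small k≡ k≤ r≡ XY≡ XY≤ r≤ = weaken time id (loop {Q₁ = _≡ s₂}
      (positive k≡)
      (testCost≤ {s} (1≤bits V) counter (reads small counter _))
      (step small (short (decrement {s} k≡) k≤′) λ small₁ → _ , _ , ⇓write ,
        writeCost≤ {s₁} (1≤bits V) (# 0) addition tt
          ((tt , len≤ (cell small₁ 0 _ (+ 0))) ,
           ((tt , len≤ (cell small₁ 4 _ (+ 0))) , subst (λ z → len z ≤ L) (sym X≡) (bits-mono (proj₁ (XY≤ k)))) ,
           ((tt , len≤ (cell small₁ 4 _ (+ 0))) , subst (λ z → len z ≤ L) (sym Y≡) (bits-mono (proj₁ (proj₂ (XY≤ k)))))) ,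
        refl)
      (λ { refl → weaken ≤-refl (λ eq → trans eq (trans (ℤ.+-assoc r _ _) (cong (λ z → r ℤ.+ z) (ℤ.+-comm (X k ℤ.* Y k) _))))
        (accumulate-run k X Y K (r ℤ.+ X k ℤ.* Y k)
          (small-update 0 (+ 0) (small-update 4 (+ 0) small (short (decrement {s} k≡) k≤′)) (within (bits-mono
            (subst (λ z → ∣ z ∣ ≤ V) (sym r′≡) (≤-trans (m≤m+n _ (k * K)) r′≤)))))
          (decrement {s} k≡) k≤′ r′≡ (λ i i<k → XY≡ i (m<n⇒m<1+n i<k)) XY≤ r′≤) }))
      where
      addition = 0 [ # 0 ] ⊞ 6 [ counter ] ⊠ 7 [ counter ]
      k≤′ = ≤-trans (n≤1+n k) k≤
      s₁ = s [ 4 , + 0 ↦ eval s (counter ⊟ # 1) ]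
      s₂ = s₁ [ 0 , + 0 ↦ eval s₁ addition ]
      X≡ : s 6 (s 4 (+ 0) ℤ.- 1ℤ) ≡ X k
      X≡ = trans (cong (s 6) (decrement {s} k≡)) (proj₁ (XY≡ k ≤-refl))
      Y≡ : s 7 (s 4 (+ 0) ℤ.- 1ℤ) ≡ Y k
      Y≡ = trans (cong (s 7) (decrement {s} k≡)) (proj₂ (XY≡ k ≤-refl))
      r′≡ : eval s₁ addition ≡ r ℤ.+ X k ℤ.* Y k
      r′≡ = cong₂ ℤ._+_ r≡ (cong₂ ℤ._*_ X≡ Y≡)
      r′≤ : ∣ r ℤ.+ X k ℤ.* Y k ∣ + k * K ≤ V
      r′≤ = ≤-trans (+-monoˡ-≤ (k * K) (≤-trans (ℤ.∣i+j∣≤∣i∣+∣j∣ r (X k ℤ.* Y k)) (+-monoʳ-≤ ∣ r ∣ (proj₂ (proj₂ (XY≤ k))))))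
        (≤-trans (≤-reflexive (+-assoc ∣ r ∣ K (k * K))) r≤)
      time : κᵗ counter * L + κᶜ accumulate-step * L + suc k * (accumulateTime * L) ≤ suc (suc k) * (accumulateTime * L)
      time = ≤-reflexive (cong (_+ suc k * (accumulateTime * L)) (sym (*-distribʳ-+ L (κᵗ counter) (κᶜ accumulate-step))))

    module Phases (n : ℕ) (n≤V : n ≤ V)
      (N²≤V : d ^ (n / 2 + n % 2) * d ^ (n / 2 + n % 2) ≤ V)
      (G H : ℕ → ℤ) (c : ℤ → ℤ) where

      q p : ℕ
      q = n / 2
      p = n / 2 + n % 2

      N Q : ℕ
      N = d ^ p
      Q = d ^ q

      instance
        N≢0 : NonZero N
        N≢0 = m^n≢0 d p

      N≤V : N ≤ V
      N≤V = ≤-trans (m≤m*n N N) N²≤V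

      Q≤V : Q ≤ V
      Q≤V = ≤-trans (^-monoʳ-≤ d (m≤m+n q (n % 2))) N≤V

      q+p≡n : q + p ≡ n
      q+p≡n = begin
        q + (q + n % 2)    ≡⟨ +-assoc q q (n % 2) ⟨
        q + q + n % 2      ≡⟨ cong (λ z → q + z + n % 2) (+-identityʳ q) ⟨
        2 * q + n % 2      ≡⟨ cong (_+ n % 2) (*-comm 2 q) ⟩
        q * 2 + n % 2      ≡⟨ +-comm (q * 2) (n % 2) ⟩
        n % 2 + q * 2      ≡⟨ m≡m%n+[m/n]*n n 2 ⟨
        n                  ∎
        where open ≡-Reasoning

      -- The subscript numbers the products, not the halves of v: the 0/1-matrix of the second half
      -- is `B₁`, that of the first half is `A₂`.
      A₁ B₁ A₂ B₂ : Matrix N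
      A₁ = matrix N (λ i k → G (i * N + k))
      B₁ = matrix N (χ c p q)
      A₂ = matrix N (χ c q 0)
      B₂ = matrix N (λ k j → H (k * N + j))

      setupTime : ℕ
      setupTime = κᶜ setup₁ * L + (suc q * (powerTime * L) + κᶜ setup₂ * L)

      setup-run : ∀ {s} → Small s → s 0 (+ 0) ≡ + n → Run setup s setupTime λ s′ →
        Small s′ × s′ 4 (+ 0) ≡ + (N * N) × s′ 4 (+ 1) ≡ + N × s′ 4 (+ 2) ≡ + Q ×
        (∀ i → s′ 6 i ≡ (s [ 6 , + 0 ↦ + N ]) 6 i) × (∀ i → s′ 7 i ≡ (s [ 7 , + 0 ↦ + N ]) 7 i) ×
        (∀ b i → 4 ≢ b → 6 ≢ b → 7 ≢ b → s′ b i ≡ s b i)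
      setup-run {s} small n≡ =
        _>>=_ {Q₁ = λ s′ → Small s′ × s′ 4 (+ 0) ≡ + q × s′ 4 (+ 2) ≡ + 1 × (∀ b i → 4 ≢ b → s′ b i ≡ s b i)}
          (step small (short q≡ (≤-trans (m/n≤m n 2) n≤V)) λ small₁ →
           last small₁ (short refl 1≤V) λ small₂ → small₂ , q≡ , refl , frame₁) λ (small₁ , q≡ , 1≡ , fr₁) →
        _>>=_ (power-run q 0 small₁ q≡ 1≡ (≤-trans (m/n≤m n 2) n≤V) (subst (λ z → d ^ z ≤ V) (sym (+-identityʳ q)) Q≤V))
          λ {s₁} (small₂ , Q≡ , fr₂) → final s₁ small₂ (trans Q≡ (cong (λ z → + (d ^ z)) (+-identityʳ q)))
            (λ b i 4≢b → trans (fr₂ b i 4≢b) (fr₁ b i 4≢b))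
        where
        q≡ : eval s (0 [ # 0 ] ⊘ # 2) ≡ + q
        q≡ = trans (cong (λ z → ⟦ div ⟧ z (+ 2)) n≡) (div-ℕ n 2)
        frame₁ : ∀ b i → 4 ≢ b → ((s [ 4 , + 0 ↦ eval s (0 [ # 0 ] ⊘ # 2) ]) [ 4 , + 2 ↦ + 1 ]) b i ≡ s b i
        frame₁ b i 4≢b rewrite dec-false (4 ≟ b) 4≢b = refl
        final : ∀ s₁ → Small s₁ → s₁ 4 (+ 2) ≡ + Q → (∀ b i → 4 ≢ b → s₁ b i ≡ s b i) → Run setup₂ s₁ (κᶜ setup₂ * L) λ s′ →
          Small s′ × s′ 4 (+ 0) ≡ + (N * N) × s′ 4 (+ 1) ≡ + N × s′ 4 (+ 2) ≡ + Q ×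
          (∀ i → s′ 6 i ≡ (s [ 6 , + 0 ↦ + N ]) 6 i) × (∀ i → s′ 7 i ≡ (s [ 7 , + 0 ↦ + N ]) 7 i) ×
          (∀ b i → 4 ≢ b → 6 ≢ b → 7 ≢ b → s′ b i ≡ s b i)
        final s₁ small Q≡ fr =
          step small (short N≡ N≤V) λ small₁ →
          step small₁ (short N≡ N≤V) λ small₂ →
          step small₂ (short N≡ N≤V) λ small₃ →
          last small₃ (short N²≡ N²≤V) λ small₄ → small₄ , N²≡ , N≡ , Q≡ , six , seven , frame₄
          where
          sizeExp = half ⊠ (# 1 ⊞ (0 [ # 0 ] ⊟ (0 [ # 0 ] ⊘ # 2) ⊠ # 2) ⊠ # (d ∸ 1))
          remainder : ∀ r → r < 2 → 1 + r * (d ∸ 1) ≡ d ^ r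
          remainder zero          _ = refl
          remainder (suc zero)    _ = trans (cong suc (+-identityʳ (d ∸ 1))) (trans (m+[n∸m]≡n (≤-trans (n≤1+n 1) 2≤d)) (sym (*-identityʳ d)))
          remainder (suc (suc _)) (s≤s (s≤s ()))
          r≡ : eval s₁ (0 [ # 0 ] ⊟ (0 [ # 0 ] ⊘ # 2) ⊠ # 2) ≡ + (n % 2)
          r≡ = trans (cong (λ z → z ℤ.- ⟦ div ⟧ z (+ 2) ℤ.* + 2) (trans (fr 0 (+ 0) (λ ())) n≡)) (mod-ℕ n 2)
          N≡ : eval s₁ sizeExp ≡ + N
          N≡ = begin
            s₁ 4 (+ 2) ℤ.* (1ℤ ℤ.+ eval s₁ (0 [ # 0 ] ⊟ (0 [ # 0 ] ⊘ # 2) ⊠ # 2) ℤ.* + (d ∸ 1))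
              ≡⟨ cong₂ (λ a b → a ℤ.* (1ℤ ℤ.+ b ℤ.* + (d ∸ 1))) Q≡ r≡ ⟩
            + Q ℤ.* (1ℤ ℤ.+ + (n % 2) ℤ.* + (d ∸ 1))
              ≡⟨ cong (λ z → + Q ℤ.* (1ℤ ℤ.+ z)) (ℤ.pos-* (n % 2) (d ∸ 1)) ⟨
            + Q ℤ.* + (1 + n % 2 * (d ∸ 1))
              ≡⟨ ℤ.pos-* Q _ ⟨
            + (Q * (1 + n % 2 * (d ∸ 1)))
              ≡⟨ cong (λ z → + (Q * z)) (remainder (n % 2) (m%n<n n 2)) ⟩
            + (Q * d ^ (n % 2))
              ≡⟨ cong +_ (^-distribˡ-+-* d q (n % 2)) ⟨
            + N ∎
            where open ≡-Reasoning
          N²≡ : eval s₁ sizeExp ℤ.* eval s₁ sizeExp ≡ + (N * N)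
          N²≡ = trans (cong (λ z → z ℤ.* z) N≡) (sym (ℤ.pos-* N N))
          s₂ = s₁ [ 4 , + 1 ↦ eval s₁ sizeExp ]
          s₃ = s₂ [ 6 , + 0 ↦ eval s₁ sizeExp ]
          s₄ = s₃ [ 7 , + 0 ↦ eval s₁ sizeExp ]
          s₅ = s₄ [ 4 , + 0 ↦ eval s₁ sizeExp ℤ.* eval s₁ sizeExp ]
          six : ∀ i → s₅ 6 i ≡ (s [ 6 , + 0 ↦ + N ]) 6 i
          six i = cong₂ (λ x y → if does (+ 0 ℤ.≟ i) then x else y) N≡ (fr 6 i (λ ()))
          seven : ∀ i → s₅ 7 i ≡ (s [ 7 , + 0 ↦ + N ]) 7 i
          seven i = cong₂ (λ x y → if does (+ 0 ℤ.≟ i) then x else y) N≡ (fr 7 i (λ ()))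
          frame₄ : ∀ b i → 4 ≢ b → 6 ≢ b → 7 ≢ b → s₅ b i ≡ s b i
          frame₄ b i 4≢b 6≢b 7≢b rewrite dec-false (4 ≟ b) 4≢b | dec-false (6 ≟ b) 6≢b | dec-false (7 ≟ b) 7≢b = fr b i 4≢b

      prepareTime : ℕ
      prepareTime = κᶜ prepare₁ * L + (suc q * (digitsTime * L) + (κᶜ prepare₂ * L + suc p * (digitsTime * L)))

      ScalarsOnly : State → State → Set
      ScalarsOnly s s′ = ∀ b i → 4 ≢ b → 5 ≢ b → s′ b i ≡ s b i

      Counted : State → ℕ → Set
      Counted s k = s 4 (+ 0) ≡ + k × s 4 (+ 1) ≡ + N × s 4 (+ 2) ≡ + Q

      prepare-run : ∀ {k s} → k < N * N → Small s → Counted s (suc k) → (∀ i → s 3 i ≡ c i) →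
        Run prepare s prepareTime λ s′ → Small s′ × Counted s′ k ×
          s′ 4 (+ 3) ≡ χ c q 0 (k / N) (k % N) × s′ 5 (+ 4) ≡ χ c p q (k / N) (k % N) × ScalarsOnly s s′
      prepare-run {k} {s} k<N² small (t≡ , N≡ , Q≡) c≡ =
        _>>=_ {Q₁ = λ s′ → Digits s′ c q x₀ y₀ 0 1ℤ × Counted s′ k × ScalarsOnly s s′}
          (step small (short (decrement {s} t≡) k≤V) λ small₁ →
           step small₁ (short x≡ x≤V) λ small₂ →
           step small₂ (short y≡ y≤V) λ small₃ →
           step small₃ (short Q≡ Q≤V) λ small₄ →
           step small₄ (short refl z≤n) λ small₅ →
           last small₅ (short refl 1≤V) λ small₆ →
             record { small = small₆ ; x≡ = x≡ ; y≡ = y≡ ; power≡ = Q≡ ; position≡ = refl ; flag≡ = refl ; code≡ = c≡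
                    ; x≤ = x≤V ; y≤ = y≤V ; power≤ = Q≤V ; position≤ = ≤-trans (m/n≤m n 2) n≤V ; flag≤ = ≤-refl } ,
             (decrement {s} t≡ , N≡ , Q≡) , frame₁)
        λ (pre₁ , (t₁≡ , N₁≡ , Q₁≡) , fr₁) →
        _>>=_ {Q₁ = λ s′ → Small s′ × Counted s′ k × s′ 5 (+ 4) ≡ χ₁ × s′ 5 (+ 3) ≡ + q × ScalarsOnly s s′}
          (weaken ≤-refl (λ (small′ , r≡ , l≡ , fr′) → small′ ,
             (trans (fr′ 4 _ (λ ())) t₁≡ , trans (fr′ 4 _ (λ ())) N₁≡ , trans (fr′ 4 _ (λ ())) Q₁≡) ,
             trans r≡ (ℤ.*-identityˡ χ₁) , l≡ , λ b i 4≢b 5≢b → trans (fr′ b i 5≢b) (fr₁ b i 4≢b 5≢b))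
           (digits-run q pre₁))
        λ {s₁} (small₁ , (t₁≡ , N₁≡ , Q₁≡) , r₁≡ , l₁≡ , fr₁) →
        middle s₁ small₁ t₁≡ N₁≡ Q₁≡ r₁≡ l₁≡ fr₁ >>=
        λ (pre₂ , (t₂≡ , N₂≡ , Q₂≡) , r₂≡ , fr₂) →
          weaken ≤-refl (λ (small′ , r≡ , _ , fr′) → small′ ,
            (trans (fr′ 4 _ (λ ())) t₂≡ , trans (fr′ 4 _ (λ ())) N₂≡ , trans (fr′ 4 _ (λ ())) Q₂≡) ,
            trans (fr′ 4 _ (λ ())) r₂≡ , trans r≡ (ℤ.*-identityˡ _) ,
            λ b i 4≢b 5≢b → trans (fr′ b i 5≢b) (fr₂ b i 4≢b 5≢b))
          (digits-run p pre₂)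
        where
        x₀ = k / N
        y₀ = k % N
        χ₁ = χ c q 0 x₀ y₀
        k≤V : k ≤ V
        k≤V = ≤-trans (<⇒≤ k<N²) N²≤V
        x≤V : x₀ ≤ V
        x≤V = ≤-trans (m/n≤m k N) k≤V
        y≤V : y₀ ≤ V
        y≤V = ≤-trans (m%n≤m k N) k≤V
        quotient : ∀ {a b} → a ≡ + k → b ≡ + N → ⟦ div ⟧ a b ≡ + x₀
        quotient refl refl = div-ℕ k N
        rest : ∀ {a b} → a ≡ + k → b ≡ + N → a ℤ.- ⟦ div ⟧ a b ℤ.* b ≡ + y₀
        rest refl refl = mod-ℕ k N
        x≡ : ⟦ div ⟧ (s 4 (+ 0) ℤ.- 1ℤ) (s 4 (+ 1)) ≡ + x₀
        x≡ = quotient (decrement {s} t≡) N≡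
        y≡ : (s 4 (+ 0) ℤ.- 1ℤ) ℤ.- ⟦ div ⟧ (s 4 (+ 0) ℤ.- 1ℤ) (s 4 (+ 1)) ℤ.* s 4 (+ 1) ≡ + y₀
        y≡ = rest (decrement {s} t≡) N≡
        t₁ = s [ 4 , + 0 ↦ eval s (counter ⊟ # 1) ]
        t₂ = t₁ [ 5 , + 0 ↦ eval t₁ (counter ⊘ size) ]
        t₃ = t₂ [ 5 , + 1 ↦ eval t₂ (counter ⊟ (counter ⊘ size) ⊠ size) ]
        t₄ = t₃ [ 5 , + 2 ↦ eval t₃ half ]
        t₅ = t₄ [ 5 , + 3 ↦ + 0 ]
        t₆ = t₅ [ 5 , + 4 ↦ + 1 ]
        frame₁ : ScalarsOnly s t₆
        frame₁ b i 4≢b 5≢b rewrite dec-false (4 ≟ b) 4≢b | dec-false (5 ≟ b) 5≢b = refl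
        middle : ∀ s₁ → Small s₁ → s₁ 4 (+ 0) ≡ + k → s₁ 4 (+ 1) ≡ + N → s₁ 4 (+ 2) ≡ + Q →
          s₁ 5 (+ 4) ≡ χ₁ → s₁ 5 (+ 3) ≡ + q → ScalarsOnly s s₁ →
          Run prepare₂ s₁ (κᶜ prepare₂ * L) λ s′ →
            Digits s′ c p x₀ y₀ q 1ℤ × Counted s′ k × s′ 4 (+ 3) ≡ χ₁ × ScalarsOnly s s′
        middle s₁ small t≡ N≡ Q≡ r≡ l≡ fr =
          step small (short-≤1 (subst (λ z → ∣ z ∣ ≤ 1) (sym r≡) (∣χ∣≤1 c q 0 x₀ y₀))) λ small₁ →
          step small₁ (short (quotient t≡ N≡) x≤V) λ small₂ →
          step small₂ (short (rest t≡ N≡) y≤V) λ small₃ →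
          step small₃ (short N≡ N≤V) λ small₄ →
          last small₄ (short refl 1≤V) λ small₅ →
            record { small = small₅ ; x≡ = quotient t≡ N≡ ; y≡ = rest t≡ N≡ ; power≡ = N≡ ; position≡ = l≡ ; flag≡ = refl
                   ; code≡ = λ i → trans (fr 3 i (λ ()) (λ ())) (c≡ i)
                   ; x≤ = x≤V ; y≤ = y≤V ; power≤ = N≤V ; position≤ = ≤-trans (≤-reflexive q+p≡n) n≤V ; flag≤ = ≤-refl } ,
            (t≡ , N≡ , Q≡) , r≡ , frame₂
          where
          u₁ = s₁ [ 4 , + 3 ↦ eval s₁ flag ]
          u₂ = u₁ [ 5 , + 0 ↦ eval u₁ (counter ⊘ size) ]
          u₃ = u₂ [ 5 , + 1 ↦ eval u₂ (counter ⊟ (counter ⊘ size) ⊠ size) ]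
          u₄ = u₃ [ 5 , + 2 ↦ eval u₃ size ]
          u₅ = u₄ [ 5 , + 4 ↦ + 1 ]
          frame₂ : ScalarsOnly s u₅
          frame₂ b i 4≢b 5≢b rewrite dec-false (4 ≟ b) 4≢b | dec-false (5 ≟ b) 5≢b = fr b i 4≢b 5≢b

      entries : Matrix N → ℕ → ℤ
      entries A = nth 0ℤ (rowMajor A)

      -- At `k` = 0 the arrays from 6 on are two interleaved initial memories for the multiplication
      -- program; `size₁`, `size₂` and `zeros` record what is required of them besides the matrices.
      record Filling (k : ℕ) (s : State) : Set where
        field
          small   : Small s
          counted : Counted s k
          g≡      : ∀ i → s 1 (+ i) ≡ G i
          h≡      : ∀ i → s 2 (+ i) ≡ H i
          c≡      : ∀ i → s 3 i ≡ c i
          size₁   : ∀ i → s 6 i ≡ initial ((+ N ∷ []) ∷ []) 0 i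
          size₂   : ∀ i → s 7 i ≡ initial ((+ N ∷ []) ∷ []) 0 i
          eight   : Filled k (entries A₁) (s 8)
          nine    : Filled k (entries A₂) (s 9)
          ten     : Filled k (entries B₁) (s 10)
          eleven  : Filled k (entries B₂) (s 11)
          zeros   : ∀ a i → s (12 + a) i ≡ 0ℤ

      fillTime : ℕ
      fillTime = κᵗ counter * L + (prepareTime + κᶜ store * L)

      fill-step : ∀ {k s} → k < N * N → Filling (suc k) s → Run (prepare ⨾ store) s (prepareTime + κᶜ store * L) (Filling k)
      fill-step {k} {s} k<N² filling = prepare-run k<N² small counted c≡ >>= λ {s′} → final s′
        where
        open Filling filling
        G≡ : entries A₁ k ≡ G k
        G≡ = trans (nth-entry-/% A₁ (λ i k → G (i * N + k)) (λ _ _ → refl) k<N²)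
          (cong G (trans (+-comm (k / N * N) (k % N)) (sym (m≡m%n+[m/n]*n k N))))
        H≡ : entries B₂ k ≡ H k
        H≡ = trans (nth-entry-/% B₂ (λ i k → H (i * N + k)) (λ _ _ → refl) k<N²)
          (cong H (trans (+-comm (k / N * N) (k % N)) (sym (m≡m%n+[m/n]*n k N))))
        final : ∀ s′ → Small s′ × Counted s′ k ×
          s′ 4 (+ 3) ≡ χ c q 0 (k / N) (k % N) × s′ 5 (+ 4) ≡ χ c p q (k / N) (k % N) × ScalarsOnly s s′ →
          Run store s′ (κᶜ store * L) (Filling k)
        final s′ (small′ , (t≡ , N≡ , Q≡) , χ₁≡ , χ₂≡ , fr) =
          step small′ (cell small′ 4 _ (+ 3)) λ small₁ →
          step small₁ (cell small₁ 5 _ (+ 4)) λ small₂ →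
          step small₂ (cell small₂ 1 _ (s′ 4 (+ 0))) λ small₃ →
          last small₃ (cell small₃ 2 _ (s′ 4 (+ 0))) λ small₄ → record
            { small   = small₄
            ; counted = t≡ , N≡ , Q≡
            ; g≡      = λ i → trans (frame 1 (+ i)) (g≡ i)
            ; h≡      = λ i → trans (frame 2 (+ i)) (h≡ i)
            ; c≡      = λ i → trans (frame 3 i) (c≡ i)
            ; size₁   = λ i → trans (frame 6 i) (size₁ i)
            ; size₂   = λ i → trans (frame 7 i) (size₂ i)
            ; nine    = filled-update {s = s′} t≡ (trans χ₁≡ (sym (nth-entry-/% A₂ (χ c q 0) (λ _ _ → refl) k<N²))) (filled-cong (frame 9) nine)
            ; ten     = filled-update {s = s′} t≡ (trans χ₂≡ (sym (nth-entry-/% B₁ (χ c p q) (λ _ _ → refl) k<N²))) (filled-cong (frame 10) ten)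
            ; eight   = filled-update {s = s′} t≡ (trans (cong (s′ 1) t≡) (trans (frame 1 (+ k)) (trans (g≡ k) (sym G≡)))) (filled-cong (frame 8) eight)
            ; eleven  = filled-update {s = s′} t≡ (trans (cong (s′ 2) t≡) (trans (frame 2 (+ k)) (trans (h≡ k) (sym H≡)))) (filled-cong (frame 11) eleven)
            ; zeros   = λ a i → trans (fr (12 + a) i (λ ()) (λ ())) (zeros a i)
            }
          where
          frame : ∀ b {_ : T (not (b ≡ᵇ 4)) } {_ : T (not (b ≡ᵇ 5))} i → s′ b i ≡ s b i
          frame b {b≢4} {b≢5} i = fr b i (λ { refl → b≢4 }) (λ { refl → b≢5 })

      fill-run : ∀ k {s} → k ≤ N * N → Filling k s → Run fill s (suc k * fillTime) (Filling 0)
      fill-run zero {s} _ filling = exit (null (proj₁ counted))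
        (≤-trans (testCost≤ {s} (1≤bits V) counter (reads small counter _)) (≤-trans (m≤m+n _ _) (≤-reflexive (sym (+-identityʳ fillTime)))))
        filling
        where open Filling filling
      fill-run (suc k) {s} k< filling = loop (positive (proj₁ counted))
        (testCost≤ {s} (1≤bits V) counter (reads small counter _))
        (fill-step k< filling) (fill-run k (<⇒≤ k<))
        where open Filling filling

      X Y : ℕ → ℕ → ℤ
      X i j = sum N (λ k → G (i * N + k) ℤ.* χ c p q k j)
      Y i j = sum N (λ k → χ c q 0 i k ℤ.* H (k * N + j))

      I₁ I₂ : List (List ℤ)
      I₁ = (+ N ∷ []) ∷ rowMajor A₁ ∷ rowMajor B₁ ∷ []
      I₂ = (+ N ∷ []) ∷ rowMajor A₂ ∷ rowMajor B₂ ∷ []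

      filled⇒≡ : ∀ {A xss b array} → Filled 0 (entries A) array → nth [] xss b ≡ rowMajor A → ∀ i → array i ≡ initial xss b i
      filled⇒≡ F eq (+ j)      = trans (at≥ F j z≤n) (cong (λ xs → nth 0ℤ xs j) (sym eq))
      filled⇒≡ F eq -[1+ j ]   = neg F j

      empty : ∀ {z} xss b i → nth [] xss b ≡ [] → z ≡ 0ℤ → z ≡ initial xss b i
      empty xss b (+ j)    eq z≡0 rewrite eq = z≡0
      empty xss b -[1+ j ] eq z≡0 = z≡0

      first-input : ∀ {z} xs xss i → z ≡ initial (xs ∷ []) 0 i → z ≡ initial (xs ∷ xss) 0 i
      first-input xs xss (+ j)    eq = eq
      first-input xs xss -[1+ j ] eq = eq

      filling⇒even : ∀ {s} → Filling 0 s → s Even.≈ρ initial I₁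
      filling⇒even {s} filling = Even.agree agrees
        where
        open Filling filling
        agrees : ∀ a i → s (even a) i ≡ initial I₁ a i
        agrees 0 i = first-input _ (rowMajor A₁ ∷ rowMajor B₁ ∷ []) i (size₁ i)
        agrees 1 i = filled⇒≡ {A₁} {I₁} {1} eight refl i
        agrees 2 i = filled⇒≡ {B₁} {I₁} {2} ten refl i
        agrees (suc (suc (suc a))) i = empty I₁ (3 + a) i refl (zeros (a * 2) i)

      filling⇒odd : ∀ {s} → Filling 0 s → s Odd.≈ρ initial I₂
      filling⇒odd {s} filling = Odd.agree agrees
        where
        open Filling filling
        agrees : ∀ a i → s (odd a) i ≡ initial I₂ a i
        agrees 0 i = first-input _ (rowMajor A₂ ∷ rowMajor B₂ ∷ []) i (size₂ i)
        agrees 1 i = filled⇒≡ {A₂} {I₂} {1} nine refl i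
        agrees 2 i = filled⇒≡ {B₂} {I₂} {2} eleven refl i
        agrees (suc (suc (suc a))) i = empty I₂ (3 + a) i refl (zeros (1 + a * 2) i)

      product-entries : (φ ψ : ℕ → ℕ → ℤ) → ∀ {s} → Outputs s (rowMajor (matrix N φ ⊗ matrix N ψ)) →
        ∀ i → i < N * N → s 0 (+ i) ≡ sum N (λ k → φ (i / N) k ℤ.* ψ k (i % N))
      product-entries φ ψ {s} outputs i i<N² = trans
        (outputs-nth {s} {rowMajor AB} outputs (<-≤-trans i<N² (≤-reflexive (sym (length-rowMajor AB)))))
        (nth-entry-/% AB (λ i j → sum N (λ k → φ i k ℤ.* ψ k j)) (⊗-matrix N φ ψ) i<N²)
        where AB = matrix N φ ⊗ matrix N ψ

      ownTime : ℕ
      ownTime = setupTime + (suc (N * N) * fillTime + (κᶜ reset * L + suc (N * N) * (accumulateTime * L)))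

      -- A block of writes costs a constant times L. The power and digit loops have at most `suc n`
      -- ≤ `β` rounds, which accounts for the factor `β`, and the loops over all entries supply N².
      ownTime≤ : ∀ β → suc n ≤ β → ownTime ≤ ownFactor * (β * L * (N * N))
      ownTime≤ β n<β =
        +-*-≤ {u = u} setupFactor (fillFactor + fillFactor + (κᶜ reset + (accumulateTime + accumulateTime))) (once setupFactor setup≤)
          (+-*-≤ {u = u} (fillFactor + fillFactor) (κᶜ reset + (accumulateTime + accumulateTime)) (repeatedly fillFactor fill≤)
            (+-*-≤ {u = u} (κᶜ reset) (accumulateTime + accumulateTime) (once (κᶜ reset) (block (κᶜ reset)))
              (repeatedly accumulateTime (block accumulateTime))))
        where
        u = β * L * (N * N)
        1≤N² : 1 ≤ N * N
        1≤N² = *-mono-≤ (m^n>0 d p) (m^n>0 d p)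
        block : ∀ a → a * L ≤ a * (β * L)
        block a = *-monoʳ-≤ a (≤-trans (≤-reflexive (sym (*-identityˡ L))) (*-monoˡ-≤ L (≤-trans (s≤s z≤n) n<β)))
        iterate : ∀ {k} a → k ≤ n → suc k * (a * L) ≤ a * (β * L)
        iterate {k} a k≤n = begin
          suc k * (a * L)     ≤⟨ *-monoˡ-≤ (a * L) (≤-trans (s≤s k≤n) n<β) ⟩
          β * (a * L)         ≡⟨ commute β a L ⟩
          a * (β * L)         ∎
          where
          open ≤-Reasoning
          commute : ∀ x y z → x * (y * z) ≡ y * (x * z)
          commute = solve-∀
        q≤n : q ≤ n
        q≤n = m/n≤m n 2
        p≤n : p ≤ n
        p≤n = ≤-trans (m≤n+m p q) (≤-reflexive q+p≡n)
        setup≤ : setupTime ≤ setupFactor * (β * L)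
        setup≤ = +-*-≤ {u = β * L} (κᶜ setup₁) (powerTime + κᶜ setup₂) (block (κᶜ setup₁))
          (+-*-≤ {u = β * L} powerTime (κᶜ setup₂) (iterate powerTime q≤n) (block (κᶜ setup₂)))
        prepareFactor = κᶜ prepare₁ + (digitsTime + (κᶜ prepare₂ + digitsTime))
        prepare≤ : prepareTime ≤ prepareFactor * (β * L)
        prepare≤ = +-*-≤ {u = β * L} (κᶜ prepare₁) (digitsTime + (κᶜ prepare₂ + digitsTime)) (block (κᶜ prepare₁))
          (+-*-≤ {u = β * L} digitsTime (κᶜ prepare₂ + digitsTime) (iterate digitsTime q≤n)
            (+-*-≤ {u = β * L} (κᶜ prepare₂) digitsTime (block (κᶜ prepare₂)) (iterate digitsTime p≤n)))
        fill≤ : fillTime ≤ fillFactor * (β * L)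
        fill≤ = +-*-≤ {u = β * L} (κᵗ counter) (prepareFactor + κᶜ store) (block (κᵗ counter))
          (+-*-≤ {u = β * L} prepareFactor (κᶜ store) prepare≤ (block (κᶜ store)))
        once : ∀ {x} a → x ≤ a * (β * L) → x ≤ a * (β * L * (N * N))
        once a x≤ = ≤-trans x≤ (*-monoʳ-≤ a
          (≤-trans (≤-reflexive (sym (*-identityʳ (β * L)))) (*-monoʳ-≤ (β * L) 1≤N²)))
        repeatedly : ∀ {x} a → x ≤ a * (β * L) → suc (N * N) * x ≤ (a + a) * (β * L * (N * N))
        repeatedly {x} a x≤ = begin
          suc (N * N) * x                       ≤⟨ *-mono-≤ (+-monoˡ-≤ (N * N) 1≤N²) x≤ ⟩
          (N * N + N * N) * (a * (β * L))       ≡⟨ regroup (N * N) a (β * L) ⟩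
          (a + a) * (β * L * (N * N))           ∎
          where
          open ≤-Reasoning
          regroup : ∀ z a u → (z + z) * (a * u) ≡ (a + a) * (u * z)
          regroup = solve-∀

      abstract
        -- The times of the two products are handed on together with an arbitrary predicate `B`, as
        -- the bound on them is a family of inequalities that supplies no single number to add.
        query-run : ∀ {s multiply B K} →
          Small s → s 0 (+ 0) ≡ + n → (∀ i → s 1 (+ i) ≡ G i) → (∀ i → s 2 (+ i) ≡ H i) → (∀ i → s 3 i ≡ c i) →
          (∀ a i → s (6 + a) i ≡ 0ℤ) →
          Computes multiply I₁ (rowMajor (A₁ ⊗ B₁)) B → Computes multiply I₂ (rowMajor (A₂ ⊗ B₂)) B →
          (∀ i j → ∣ X i j ∣ ≤ K) → (∀ i j → ∣ Y i j ∣ ≤ K) → K ≤ V → N * N * (K * K) ≤ V →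
          Σ[ t₁ ∈ ℕ ] Σ[ t₂ ∈ ℕ ] B t₁ × B t₂ × Run (query multiply) s (ownTime + t₁ + t₂) λ s′ →
            s′ 0 (+ 0) ≡ sum N (λ i → sum N (λ j → X i j ℤ.* Y i j))
        query-run {s} {multiply} {K = K} small n≡ g≡ h≡ c≡ zeros≡ (o₁ , t₁ , run₁ , outputs₁ , b₁) (o₂ , t₂ , run₂ , outputs₂ , b₂) X≤ Y≤ K≤V bound =
          t₁ , t₂ , b₁ , b₂ , weaken (≤-reflexive rearranged) id
            (setup-run small n≡ >>= λ {s₁} post → fill-run (N * N) ≤-refl (filling s₁ post) >>= λ {s₂} → products s₂)
          where
          filling : ∀ s₁ →
            Small s₁ × s₁ 4 (+ 0) ≡ + (N * N) × s₁ 4 (+ 1) ≡ + N × s₁ 4 (+ 2) ≡ + Q ×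
            (∀ i → s₁ 6 i ≡ (s [ 6 , + 0 ↦ + N ]) 6 i) × (∀ i → s₁ 7 i ≡ (s [ 7 , + 0 ↦ + N ]) 7 i) ×
            (∀ b i → 4 ≢ b → 6 ≢ b → 7 ≢ b → s₁ b i ≡ s b i) → Filling (N * N) s₁
          filling s₁ (small₁ , N²≡ , N≡ , Q≡ , six , seven , fr) = record
            { small = small₁ ; counted = N²≡ , N≡ , Q≡
            ; g≡ = λ i → trans (frame 1 (+ i)) (g≡ i)
            ; h≡ = λ i → trans (frame 2 (+ i)) (h≡ i)
            ; c≡ = λ i → trans (frame 3 i) (c≡ i)
            ; size₁ = λ i → trans (six i) (singleton 0 i)
            ; size₂ = λ i → trans (seven i) (singleton 1 i)
            ; eight = blank A₁ 2 ; nine = blank A₂ 3 ; ten = blank B₁ 4 ; eleven = blank B₂ 5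
            ; zeros = λ a i → trans (fr (12 + a) i (λ ()) (λ ()) (λ ())) (zeros≡ (6 + a) i)
            }
            where
            frame : ∀ b {_ : T (not (b ≡ᵇ 4))} {_ : T (not (b ≡ᵇ 6))} {_ : T (not (b ≡ᵇ 7))} i → s₁ b i ≡ s b i
            frame b {b≢4} {b≢6} {b≢7} i = fr b i (λ { refl → b≢4 }) (λ { refl → b≢6 }) (λ { refl → b≢7 })
            singleton : ∀ a i → (s [ 6 + a , + 0 ↦ + N ]) (6 + a) i ≡ initial ((+ N ∷ []) ∷ []) 0 i
            singleton a (+ zero)  = update-here s (6 + a) (+ 0) (+ N)
            singleton a (+ suc j) = trans (update-index s (6 + a) {+ 0} (+ N) (λ ())) (zeros≡ a (+ suc j))
            singleton a -[1+ j ]  = trans (update-index s (6 + a) {+ 0} (+ N) (λ ())) (zeros≡ a -[1+ j ])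
            blank : ∀ A a {_ : T (not (a ≡ᵇ 0))} {_ : T (not (a ≡ᵇ 1))} → Filled (N * N) (entries A) (s₁ (6 + a))
            blank A a {a≢0} {a≢1} = record
              { at≥ = λ j N²≤j → trans (zero-cell (+ j)) (sym (nth-≥ (rowMajor A) j (≤-trans (≤-reflexive (length-rowMajor A)) N²≤j)))
              ; neg = λ j → zero-cell -[1+ j ] }
              where
              zero-cell : ∀ i → s₁ (6 + a) i ≡ 0ℤ
              zero-cell i = trans (fr (6 + a) i (λ ()) (λ { refl → a≢0 }) (λ { refl → a≢1 })) (zeros≡ a i)
          products : ∀ s₂ → Filling 0 s₂ →
            Run (rename even multiply ⨾ rename odd multiply ⨾ reset ⨾ accumulate) s₂
              (t₁ + (t₂ + (κᶜ reset * L + suc (N * N) * (accumulateTime * L)))) λ s′ →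
              s′ 0 (+ 0) ≡ sum N (λ i → sum N (λ j → X i j ℤ.* Y i j))
          products s₂ filling with Even.simulate run₁ (filling⇒even filling)
          -- The first copy leaves the odd arrays alone, so the second still finds its initial
          -- memory.
          ... | S₁ , Run₁ , S₁≈ , fr₁ with Odd.simulate run₂ (Odd.agree {S₁} {initial I₂} λ a i →
                  trans (fr₁ (odd a) (λ b → even-odd-disjoint b a) i) (Odd._≈ρ_.at (filling⇒odd filling) a i))
          ... | S₂ , Run₂ , S₂≈ , fr₂ =
            _>>=_ {Q₁ = _≡ S₁} (S₁ , t₁ , Run₁ , ≤-refl , refl) λ { refl →
            _>>=_ {Q₁ = _≡ S₂} (S₂ , t₂ , Run₂ , ≤-refl , refl) λ { refl →
            _>>=_ {Q₁ = λ s′ → Small s′ × s′ 4 (+ 0) ≡ + (N * N) × s′ 0 (+ 0) ≡ 0ℤ × (∀ i → s′ 6 i ≡ S₁ 6 i) × (∀ i → s′ 7 i ≡ S₂ 7 i)}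
              (step small₂ (short refl z≤n) λ small₃ →
               last small₃ (short N²≡ N²≤V) λ small₄ →
                 small₄ , N²≡ , refl , (λ i → fr₂ 6 (λ a eq → even-odd-disjoint 0 a (sym eq)) i) , λ _ → refl)
            λ (small₅ , N²≡ , 0≡ , six , seven) →
            weaken ≤-refl (λ eq → trans eq (trans (ℤ.+-identityˡ _) flat))
              (accumulate-run (N * N) (λ t → X (t / N) (t % N)) (λ t → Y (t / N) (t % N)) (K * K) 0ℤ small₅ N²≡ N²≤V 0≡
                (λ i i<N² →
                  trans (six (+ i)) (trans (Even._≈ρ_.at S₁≈ 0 (+ i)) (product-entries (λ i k → G (i * N + k)) (χ c p q) {o₁} outputs₁ i i<N²)) ,
                  trans (seven (+ i)) (trans (Odd._≈ρ_.at S₂≈ 0 (+ i)) (product-entries (χ c q 0) (λ k j → H (k * N + j)) {o₂} outputs₂ i i<N²)))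
                (λ i → ≤-trans (X≤ (i / N) (i % N)) K≤V , ≤-trans (Y≤ (i / N) (i % N)) K≤V ,
                  ≤-trans (≤-reflexive (ℤ.∣i*j∣≡∣i∣*∣j∣ (X (i / N) (i % N)) _)) (*-mono-≤ (X≤ (i / N) (i % N)) (Y≤ (i / N) (i % N))))
                bound) } }
            where
            open Filling filling using (counted)
            kept : ∀ b → T (b <ᵇ 6) → ∀ i → S₂ b i ≡ s₂ b i
            kept b b<6 i = trans (fr₂ b (own-outside-odd b b<6) i) (fr₁ b (own-outside-even b b<6) i)
            small₂ : Small S₂
            small₂ = cells λ b b<6 i → subst Short (sym (kept b b<6 i)) (cell (Filling.small filling) b b<6 i)
            N²≡ : S₂ 4 (+ 1) ℤ.* S₂ 4 (+ 1) ≡ + (N * N)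
            N²≡ = trans (cong (λ z → z ℤ.* z) (trans (kept 4 _ (+ 1)) (proj₁ (proj₂ counted)))) (sym (ℤ.pos-* N N))
            flat : sum (N * N) (λ t → X (t / N) (t % N) ℤ.* Y (t / N) (t % N)) ≡ sum N (λ i → sum N (λ j → X i j ℤ.* Y i j))
            flat = trans (sum-* N N _) (sum-cong N λ i _ → sum-cong N λ j j<N →
              cong₂ (λ a b → X a b ℤ.* Y a b) ([m*n+o]/n i j<N) ([m*n+o]%n i j<N))
          rearranged : setupTime + (suc (N * N) * fillTime + (t₁ + (t₂ + (κᶜ reset * L + suc (N * N) * (accumulateTime * L))))) ≡
            ownTime + t₁ + t₂
          rearranged = shuffle setupTime (suc (N * N) * fillTime) t₁ t₂ (κᶜ reset * L + suc (N * N) * (accumulateTime * L))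
            where
            shuffle : ∀ a b c d e → a + (b + (c + (d + e))) ≡ a + (b + e) + c + d
            shuffle = solve-∀

-- Bounds with a real exponent

-- Fractions are kept in lowest terms, so the comparison first concerns the reduced numerator and
-- denominator; multiplying by the gcd restores `p` and `q`.
2</⇒2*≤ : ∀ p q .{{_ : NonZero q}} → + 2 ℚ./ 1 ℚ.< + p ℚ./ q → 2 * q ≤ p
2</⇒2*≤ p q 2<p/q = ℤ.drop‿+≤+ (begin
  + (2 * q)                                          ≡⟨ ℤ.pos-* 2 q ⟩
  + 2 ℤ.* + q                                        ≡⟨ cong (λ z → + 2 ℤ.* z) (ℚ.↧-/ (+ p) q) ⟨
  + 2 ℤ.* (↧ (+ p ℚ./ q) ℤ.* ℤ.gcd (+ p) (+ q))      ≡⟨ ℤ.*-assoc (+ 2) (↧ (+ p ℚ./ q)) _ ⟨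
  + 2 ℤ.* ↧ (+ p ℚ./ q) ℤ.* ℤ.gcd (+ p) (+ q)        ≤⟨ ℤ.*-monoʳ-≤-nonNeg (ℤ.gcd (+ p) (+ q)) (ℤ.<⇒≤ (ℚ.drop-*<* 2<p/q)) ⟩
  ↥ (+ p ℚ./ q) ℤ.* + 1 ℤ.* ℤ.gcd (+ p) (+ q)        ≡⟨ cong (λ z → z ℤ.* ℤ.gcd (+ p) (+ q)) (ℤ.*-identityʳ (↥ (+ p ℚ./ q))) ⟩
  ↥ (+ p ℚ./ q) ℤ.* ℤ.gcd (+ p) (+ q)                ≡⟨ ℚ.↥-/ (+ p) q ⟩
  + p                                                ∎)
  where open ℤ.≤-Reasoning

^-cancelʳ-≤ : ∀ n .{{_ : NonZero n}} {x y} → x ^ n ≤ y ^ n → x ≤ y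
^-cancelʳ-≤ n {x} {y} x^n≤y^n with x ≤? y
... | yes x≤y = x≤y
... | no  x≰y = contradiction x^n≤y^n (<⇒≱ (^-monoˡ-< n (≰⇒> x≰y)))

^-distribʳ-* : ∀ m n o → (m * n) ^ o ≡ m ^ o * n ^ o
^-distribʳ-* m n zero    = refl
^-distribʳ-* m n (suc o) = trans (cong (m * n *_) (^-distribʳ-* m n o)) ([m*n]*[o*p]≡[m*o]*[n*p] m n (m ^ o) (n ^ o))

module _ (ω : ℝ) where

  ≤·-mono : ∀ {t t′ K K′ b i j} .{{_ : NonZero j}} → t ≤ t′ → K′ ≤ K →
    t′ ≤ K′ · b ^⟨ ω · i / j ⟩ → t ≤ K · b ^⟨ ω · i / j ⟩
  ≤·-mono {b = b} {i} {j} t≤t′ K′≤K bound p q u =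
    ≤-trans (^-monoˡ-≤ (q * j) t≤t′) (≤-trans (bound p q u) (*-monoˡ-≤ (b ^ (p * i)) (^-monoˡ-≤ (q * j) K′≤K)))

  -- The inequalities bound powers of the times, which do not add up. The detour is t₁ + t₂ ≤ 2 max
  -- (t₁ , t₂), at the price of the factor 2.
  ≤·-+ : ∀ {t₁ t₂ K b i j} .{{_ : NonZero j}} → t₁ ≤ K · b ^⟨ ω · i / j ⟩ → t₂ ≤ K · b ^⟨ ω · i / j ⟩ →
    t₁ + t₂ ≤ 2 * K · b ^⟨ ω · i / j ⟩
  ≤·-+ {t₁} {t₂} {K} {b} {i} {j} bound₁ bound₂ p q u = begin
    (t₁ + t₂) ^ (q * j)                             ≤⟨ ^-monoˡ-≤ (q * j) (+-mono-≤ (m≤m⊔n t₁ t₂) (m≤n⊔m t₁ t₂)) ⟩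
    (t + t) ^ (q * j)                               ≡⟨ cong (λ z → (t + z) ^ (q * j)) (+-identityʳ t) ⟨
    (2 * t) ^ (q * j)                               ≡⟨ ^-distribʳ-* 2 t (q * j) ⟩
    2 ^ (q * j) * t ^ (q * j)                       ≤⟨ *-monoʳ-≤ (2 ^ (q * j)) max ⟩
    2 ^ (q * j) * (K ^ (q * j) * b ^ (p * i))       ≡⟨ *-assoc (2 ^ (q * j)) _ _ ⟨
    2 ^ (q * j) * K ^ (q * j) * b ^ (p * i)         ≡⟨ cong (_* b ^ (p * i)) (^-distribʳ-* 2 K (q * j)) ⟨
    (2 * K) ^ (q * j) * b ^ (p * i)                 ∎
    where
    open ≤-Reasoning
    t = t₁ ⊔ t₂
    max : t ^ (q * j) ≤ K ^ (q * j) * b ^ (p * i)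
    max with ⊔-sel t₁ t₂
    ... | inj₁ eq rewrite eq = bound₁ p q u
    ... | inj₂ eq rewrite eq = bound₂ p q u

  -- Here the N² steps spent on filling and summing the matrices are absorbed by N ^ ω, since ω ≥ 2.
  ≤·-square : ∀ {K b} .{{_ : NonZero b}} → + 2 ℚ./ 1 ≤ʳ ω → K * (b * b) ≤ K · b ^⟨ ω · 1 / 1 ⟩
  ≤·-square {K} {b} 2≤ω p q u = begin
    (K * (b * b)) ^ (q * 1)              ≡⟨ ^-distribʳ-* K (b * b) (q * 1) ⟩
    K ^ (q * 1) * (b * b) ^ (q * 1)      ≡⟨ cong (λ z → K ^ (q * 1) * z) (trans (cong₂ (λ x y → (b * x) ^ y) (sym (*-identityʳ b)) (*-identityʳ q)) (^-*-assoc b 2 q)) ⟩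
    K ^ (q * 1) * b ^ (2 * q)            ≤⟨ *-monoʳ-≤ (K ^ (q * 1)) (^-monoʳ-≤ b (2</⇒2*≤ p q (2≤ω u))) ⟩
    K ^ (q * 1) * b ^ p                  ≡⟨ cong (λ z → K ^ (q * 1) * b ^ z) (*-identityʳ p) ⟨
    K ^ (q * 1) * b ^ (p * 1)            ∎
    where open ≤-Reasoning

  -- For odd n the exponent n / 2 is rounded up, which costs a factor d ^ (p / 2q)
  -- at the bound p / q > ω.  Below p₀ / q₀ this is at most d ^ p₀; a bound at
  -- p₀ / q₀ implies all bounds above it.
  ≤·-half : ∀ {t K N d n} .{{_ : NonZero d}} p₀ q₀ .{{_ : NonZero q₀}} → upper ω (+ p₀ ℚ./ q₀) →
    N * N ≤ d * d ^ n → t ≤ K · N ^⟨ ω · 1 / 1 ⟩ → t ≤ K * d ^ p₀ · d ^⟨ ω · n / 2 ⟩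
  ≤·-half {t} {K} {N} {d} {n} p₀ q₀ u₀ N²≤ bound p q u = cases (≤-total (p * q₀) (p₀ * q))
    where
    open ≤-Reasoning

    rounded : ∀ p q .{{_ : NonZero q}} → upper ω (+ p ℚ./ q) → t ^ (q * 2) ≤ K ^ (q * 2) * (d ^ p * d ^ (p * n))
    rounded p q u = begin
      t ^ (q * 2)                                      ≡⟨ ^-*-assoc t q 2 ⟨
      (t ^ q) ^ 2                                      ≡⟨ cong (λ z → (t ^ z) ^ 2) (*-identityʳ q) ⟨
      (t ^ (q * 1)) ^ 2                                ≤⟨ ^-monoˡ-≤ 2 (bound p q u) ⟩
      (K ^ (q * 1) * N ^ (p * 1)) ^ 2                  ≡⟨ cong₂ (λ x y → (K ^ x * N ^ y) ^ 2) (*-identityʳ q) (*-identityʳ p) ⟩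
      (K ^ q * N ^ p) ^ 2                              ≡⟨ ^-distribʳ-* (K ^ q) (N ^ p) 2 ⟩
      (K ^ q) ^ 2 * (N ^ p) ^ 2                        ≡⟨ cong₂ _*_ (^-*-assoc K q 2) (trans (cong (N ^ p *_) (*-identityʳ (N ^ p))) (sym (^-distribʳ-* N N p))) ⟩
      K ^ (q * 2) * (N * N) ^ p                        ≤⟨ *-monoʳ-≤ (K ^ (q * 2)) (^-monoˡ-≤ p N²≤) ⟩
      K ^ (q * 2) * (d * d ^ n) ^ p                    ≡⟨ cong (K ^ (q * 2) *_) (^-distribʳ-* d (d ^ n) p) ⟩
      K ^ (q * 2) * (d ^ p * (d ^ n) ^ p)              ≡⟨ cong (λ z → K ^ (q * 2) * (d ^ p * z)) (trans (^-*-assoc d n p) (cong (d ^_) (*-comm n p))) ⟩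
      K ^ (q * 2) * (d ^ p * d ^ (p * n))              ∎

    absorb : ∀ q p → p ≤ p₀ * (q * 2) → K ^ (q * 2) * (d ^ p * d ^ (p * n)) ≤ (K * d ^ p₀) ^ (q * 2) * d ^ (p * n)
    absorb q p p≤ = begin
      K ^ (q * 2) * (d ^ p * d ^ (p * n))              ≡⟨ *-assoc (K ^ (q * 2)) _ _ ⟨
      K ^ (q * 2) * d ^ p * d ^ (p * n)                ≤⟨ *-monoˡ-≤ (d ^ (p * n)) (*-monoʳ-≤ (K ^ (q * 2)) (^-monoʳ-≤ d p≤)) ⟩
      K ^ (q * 2) * d ^ (p₀ * (q * 2)) * d ^ (p * n)   ≡⟨ cong (λ z → K ^ (q * 2) * z * d ^ (p * n)) (^-*-assoc d p₀ (q * 2)) ⟨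
      K ^ (q * 2) * (d ^ p₀) ^ (q * 2) * d ^ (p * n)   ≡⟨ cong (_* d ^ (p * n)) (^-distribʳ-* K (d ^ p₀) (q * 2)) ⟨
      (K * d ^ p₀) ^ (q * 2) * d ^ (p * n)             ∎

    swap : ∀ x q → (x ^ (q₀ * 2)) ^ q ≡ (x ^ (q * 2)) ^ q₀
    swap x q = begin-equality
      (x ^ (q₀ * 2)) ^ q    ≡⟨ ^-*-assoc x (q₀ * 2) q ⟩
      x ^ (q₀ * 2 * q)      ≡⟨ cong (x ^_) (permute q₀ q) ⟩
      x ^ (q * 2 * q₀)      ≡⟨ ^-*-assoc x (q * 2) q₀ ⟨
      (x ^ (q * 2)) ^ q₀    ∎
      where
      permute : ∀ a b → a * 2 * b ≡ b * 2 * a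
      permute = solve-∀

    exponent : p₀ * q ≤ p * q₀ → p₀ * n * q ≤ p * n * q₀
    exponent large = begin
      p₀ * n * q       ≡⟨ permute p₀ n q ⟩
      p₀ * q * n       ≤⟨ *-monoˡ-≤ n large ⟩
      p * q₀ * n       ≡⟨ permute p q₀ n ⟩
      p * n * q₀       ∎
      where
      permute : ∀ a b c → a * b * c ≡ a * c * b
      permute = solve-∀

    cases : p * q₀ ≤ p₀ * q ⊎ p₀ * q ≤ p * q₀ → t ^ (q * 2) ≤ (K * d ^ p₀) ^ (q * 2) * d ^ (p * n)
    cases (inj₁ small) = ≤-trans (rounded p q u)
      (absorb q p (≤-trans (m≤m*n p q₀) (≤-trans small (*-monoʳ-≤ p₀ (m≤m*n q 2)))))
    -- After raising the claim to the power `q₀` and the bound at p₀ / q₀ to the power `q`, both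
    -- concern the same power of `t`.
    cases (inj₂ large) = ^-cancelʳ-≤ q₀ (begin
      (t ^ (q * 2)) ^ q₀                                           ≡⟨ swap t q ⟨
      (t ^ (q₀ * 2)) ^ q                                           ≤⟨ ^-monoˡ-≤ q (rounded p₀ q₀ u₀) ⟩
      (K ^ (q₀ * 2) * (d ^ p₀ * d ^ (p₀ * n))) ^ q                 ≤⟨ ^-monoˡ-≤ q (absorb q₀ p₀ (≤-trans (m≤m*n p₀ (q₀ * 2) {{m*n≢0 q₀ 2}}) ≤-refl)) ⟩
      ((K * d ^ p₀) ^ (q₀ * 2) * d ^ (p₀ * n)) ^ q                 ≡⟨ ^-distribʳ-* ((K * d ^ p₀) ^ (q₀ * 2)) (d ^ (p₀ * n)) q ⟩
      ((K * d ^ p₀) ^ (q₀ * 2)) ^ q * (d ^ (p₀ * n)) ^ q           ≡⟨ cong₂ _*_ (swap (K * d ^ p₀) q) (^-*-assoc d (p₀ * n) q) ⟩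
      ((K * d ^ p₀) ^ (q * 2)) ^ q₀ * d ^ (p₀ * n * q)             ≤⟨ *-monoʳ-≤ (((K * d ^ p₀) ^ (q * 2)) ^ q₀) (^-monoʳ-≤ d (exponent large)) ⟩
      ((K * d ^ p₀) ^ (q * 2)) ^ q₀ * d ^ (p * n * q₀)             ≡⟨ cong (((K * d ^ p₀) ^ (q * 2)) ^ q₀ *_) (^-*-assoc d (p * n) q₀) ⟨
      ((K * d ^ p₀) ^ (q * 2)) ^ q₀ * (d ^ (p * n)) ^ q₀           ≡⟨ ^-distribʳ-* ((K * d ^ p₀) ^ (q * 2)) (d ^ (p * n)) q₀ ⟨
      ((K * d ^ p₀) ^ (q * 2) * d ^ (p * n)) ^ q₀                  ∎)

  -- Supplies the fixed p₀ / q₀ for `≤·-half`. It depends on ω alone, so that `d ^ p₀` is a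
  -- constant; a negative numerator is excluded by ω ≥ 2.
  upper-fraction : + 2 ℚ./ 1 ≤ʳ ω → Σ[ p ∈ ℕ ] Σ[ q ∈ ℕ ] Σ[ q≢0 ∈ NonZero q ] upper ω (ℚ._/_ (+ p) q {{q≢0}})
  upper-fraction 2≤ω = fraction (upper-inhabited ω)
    where
    fraction : ∃ (upper ω) → Σ[ p ∈ ℕ ] Σ[ q ∈ ℕ ] Σ[ q≢0 ∈ NonZero q ] upper ω (ℚ._/_ (+ p) q {{q≢0}})
    fraction (r@(mkℚ (+ p) q-1 _) , u)    = p , suc q-1 , _ , subst (upper ω) (sym (ℚ.↥p/↧p≡p r)) u
    fraction (r@(mkℚ -[1+ _ ] _ _) , u) with ℚ.drop-*<* (2≤ω u)
    ... | ()

-- The reduction to matrix multiplication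

n<2^n : ∀ n → n < 2 ^ n
n<2^n zero    = s≤s z≤n
n<2^n (suc n) = ≤-trans (+-mono-≤ (m^n>0 2 n) (n<2^n n)) (≤-reflexive (cong (λ z → 2 ^ n + z) (sym (+-identityʳ (2 ^ n)))))

∣nth-map∣≤ : ∀ {A : Set} {K} (F : A → ℤ) → (∀ x → ∣ F x ∣ ≤ K) → ∀ xs i → ∣ nth 0ℤ (map F xs) i ∣ ≤ K
∣nth-map∣≤ F F≤ []       i       = z≤n
∣nth-map∣≤ F F≤ (x ∷ xs) zero    = F≤ x
∣nth-map∣≤ F F≤ (x ∷ xs) (suc i) = ∣nth-map∣≤ F F≤ xs i

∣nth-toList∣≤ : ∀ {A : Set} {K} (F : A → ℤ) → (∀ x → ∣ F x ∣ ≤ K) → ∀ {n} (v : Vec A n) i →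
  ∣ nth 0ℤ (Vec.toList (Vec.map F v)) i ∣ ≤ K
∣nth-toList∣≤ F F≤ []      i       = z≤n
∣nth-toList∣≤ F F≤ (x ∷ v) zero    = F≤ x
∣nth-toList∣≤ F F≤ (x ∷ v) (suc i) = ∣nth-toList∣≤ F F≤ v i

-- At most one letter

module Trivial {D : Set} {d : ℕ} (d≤1 : d ≤ 1) (enum : D ↔ Fin d) (f : D → D → D) where

  open FQuery enum f

  letters : ∀ {d} → d ≤ 1 → (enum : D ↔ Fin d) → ∀ a → map (Inverse.from enum) (allFin d) ≡ a ∷ []
  letters {zero}        _ enum a with Inverse.to enum a
  ... | ()
  letters {suc zero}    _ enum a = cong (_∷ []) (trans (cong (Inverse.from enum) (only (Inverse.to enum a))) (Inverse.strictlyInverseʳ enum a))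
    where
    only : ∀ (i : Fin 1) → zero ≡ i
    only zero = refl
  letters {suc (suc _)} (s≤s ()) enum a

  vectors-singleton : ∀ {n} (v : Vec D n) → vectors n ≡ v ∷ []
  vectors-singleton []      = refl
  vectors-singleton (a ∷ v) rewrite letters d≤1 enum a | vectors-singleton v = refl

  ⊛-singleton : ∀ {n} (g h : Vec D n → ℤ) v → (g ⊛ h) v ≡ g v ℤ.* h v
  ⊛-singleton {n} g h v rewrite vectors-singleton v
    | dec-true (Vec.≡-dec _≟ᴰ_ v (v ⊕ v)) (List.∷-injectiveˡ (trans (sym (vectors-singleton v)) (vectors-singleton (v ⊕ v))))
    = ℤ.+-identityʳ _

  -- As d ^ n ≤ 1, the permitted time does not grow with n. Since v exists, it is the only vector,
  -- and each value list has exactly one entry.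
  multiplyHeads : Cmd
  multiplyHeads = 0 [ # 0 ]≔ 1 [ # 0 ] ⊠ 2 [ # 0 ]

  -- For d = 0 the existence of `v` forces n = 0, where the power is 0 ^ 0 = 1.
  1≤d^ : ∀ {d} → D ↔ Fin d → ∀ {n} (v : Vec D n) p → 1 ≤ d ^ (p * n)
  1≤d^ {zero}  enum []      p rewrite *-zeroʳ p = ≤-refl
  1≤d^ {zero}  enum (a ∷ v) p with Inverse.to enum a
  ... | ()
  1≤d^ {suc d} enum {n} v   p = m^n>0 (suc d) (p * n)

  solves : ∀ ω → SolvesQueryIn ω multiplyHeads (κᶜ multiplyHeads) 1
  solves ω n g h v M g≤ h≤ = _ , _ , ⇓write , (λ { zero → trans product (sym (⊛-singleton g h v)) }) , λ p q _ → begin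
    writeCost s (# 0) product′ ^ (q * 2)                                       ≤⟨ ^-monoˡ-≤ (q * 2) (writeCost≤ {s} (1≤bits M) (# 0) product′ tt ((tt , short g g≤) , (tt , short h h≤))) ⟩
    (κᶜ multiplyHeads * bits M) ^ (q * 2)                                      ≤⟨ ^-monoˡ-≤ (q * 2) (*-mono-≤ (m≤m*n (κᶜ multiplyHeads) (bits (d ^ n) ^ 1)) (≤-reflexive (sym (*-identityʳ (bits M))))) ⟩
    (κᶜ multiplyHeads * bits (d ^ n) ^ 1 * bits M ^ 1) ^ (q * 2)               ≤⟨ m≤m*n _ (d ^ (p * n)) {{>-nonZero (1≤d^ enum v p)}} ⟩
    (κᶜ multiplyHeads * bits (d ^ n) ^ 1 * bits M ^ 1) ^ (q * 2) * d ^ (p * n) ∎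
    where
    open ≤-Reasoning
    product′ = 1 [ # 0 ] ⊠ 2 [ # 0 ]
    s = initial (input g h v)
    product : nth 0ℤ (map g (vectors n)) 0 ℤ.* nth 0ℤ (map h (vectors n)) 0 ≡ g v ℤ.* h v
    product rewrite vectors-singleton v = refl
    short : ∀ (g : Vec D n → ℤ) → (∀ u → ∣ g u ∣ ≤ M) → len (nth 0ℤ (map g (vectors n)) 0) ≤ bits M
    short g g≤ = bits-mono (∣nth-map∣≤ g g≤ (vectors n) 0)

  solvable : ∀ ω → Σ[ P ∈ Cmd ] Σ[ C ∈ ℕ ] Σ[ k ∈ ℕ ] SolvesQueryIn ω P C k
  solvable ω = multiplyHeads , κᶜ multiplyHeads , 1 , solves ω

module Reduction {ω : ℝ} (multiplication : IsMatMulExponent ω) {D : Set} {d : ℕ} .{{d≢0 : NonZero d}} (2≤d : 2 ≤ d)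
  (enum : D ↔ Fin d) (f : D → D → D) where

  open IsMatMulExponent multiplication
  open FQuery enum f
  open Query enum f
  open Programs 2≤d enum f

  p₀ : ℕ
  p₀ = proj₁ (upper-fraction ω 2≤ω)

  -- The first summand serves `own≤`, with `2 * (bits d + 3)` taken from `L≤`; the second serves
  -- `product≤`, where `bits N` and `bits (suc M)` are traded for `β` and `μ`.
  factor : ℕ
  factor = ownFactor * (2 * (bits d + 3)) + C * ((bits d + 1) ^ k * 2 ^ k)

  module _ (n : ℕ) (g h : Vec D n → ℤ) (v : Vec D n) (M : ℕ) (g≤ : ∀ u → ∣ g u ∣ ≤ M) (h≤ : ∀ u → ∣ h u ∣ ≤ M) where

    s₀ : State
    s₀ = initial (input g h v)

    -- `E` bounds N², and `V` bounds all numbers handled outside the multiplications. The largest is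
    -- the final sum of N² products of two entries of size at most N (M + 1): in total (N² (M + 1))²
    -- ≤ `W * W`. Using M + 1 also covers the 0/1-entries when M = 0. The exponent `2 + k` has room
    -- for β² μ from the own time and for β ^ k μ ^ k from the products.
    E W V β μ K₀ : ℕ
    E = d * d ^ n
    W = E * suc M
    V = W * W
    β = bits (d ^ n)
    μ = bits M
    K₀ = factor * (β ^ (2 + k) * μ ^ (2 + k))

    instance
      E≢0 : NonZero E
      E≢0 = m^n≢0 d (suc n)
      W≢0 : NonZero W
      W≢0 = m*n≢0 E (suc M)

    W≤V : W ≤ V
    W≤V = m≤m*n W W

    E≤V : E ≤ V
    E≤V = ≤-trans (m≤m*n E (suc M)) W≤V

    N²≤E : d ^ (n / 2 + n % 2) * d ^ (n / 2 + n % 2) ≤ E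
    N²≤E = ≤-trans (≤-reflexive (sym (^-distribˡ-+-* d (n / 2 + n % 2) (n / 2 + n % 2)))) (^-monoʳ-≤ d (begin
      (n / 2 + n % 2) + (n / 2 + n % 2)                                ≡⟨ double (n / 2) (n % 2) ⟩
      n % 2 + (n % 2 + n / 2 * 2)          ≡⟨ cong (λ z → n % 2 + z) (m≡m%n+[m/n]*n n 2) ⟨
      n % 2 + n                            ≤⟨ +-monoˡ-≤ n (s≤s⁻¹ (m%n<n n 2)) ⟩
      suc n                                ∎))
      where
      open ≤-Reasoning
      double : ∀ q r → (q + r) + (q + r) ≡ r + (r + q * 2)
      double = solve-∀

    n≤V : n ≤ V
    n≤V = ≤-trans (<⇒≤ (n<2^n n)) (≤-trans (^-monoˡ-≤ n 2≤d) (≤-trans (m≤n*m (d ^ n) d) E≤V))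

    open Correctness V (>-nonZero⁻¹ V {{m*n≢0 W W}})
    open Phases n n≤V (≤-trans N²≤E E≤V) (values g) (values h) (s₀ 3)

    values≤ : ∀ (g : Vec D n → ℤ) → (∀ u → ∣ g u ∣ ≤ M) → ∀ i → ∣ values g i ∣ ≤ suc M
    values≤ g g≤ i = ≤-trans (∣nth-map∣≤ g g≤ (vectors n) i) (n≤1+n M)

    χ≤ : ∀ k j x y → ∣ χ (s₀ 3) k j x y ∣ ≤ suc M
    χ≤ k j x y = ≤-trans (∣χ∣≤1 (s₀ 3) k j x y) (s≤s z≤n)

    M<V : suc M ≤ V
    M<V = ≤-trans (m≤n*m (suc M) E) W≤V

    small₀ : Small s₀
    small₀ = cells initially
      where
      initially : ∀ a → T (a <ᵇ 6) → ∀ i → Short (s₀ a i)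
      initially 0 _ (+ zero)  = short refl n≤V
      initially 0 _ (+ suc i) = short refl z≤n
      initially 1 _ (+ i)     = within (bits-mono (≤-trans (values≤ g g≤ i) M<V))
      initially 2 _ (+ i)     = within (bits-mono (≤-trans (values≤ h h≤ i) M<V))
      initially 3 _ (+ i)     = within (bits-mono (≤-trans (∣nth-toList∣≤ code (λ x → <⇒≤ (Fin.toℕ<n (Inverse.to enum x))) v i)
        (≤-trans (m≤m*n d (d ^ n) {{m^n≢0 d n}}) E≤V)))
      initially 4 _ (+ i)     = short refl z≤n
      initially 5 _ (+ i)     = short refl z≤n
      initially a _ -[1+ i ]  = short refl z≤n

    zeros₀ : ∀ a i → s₀ (6 + a) i ≡ 0ℤ
    zeros₀ a (+ i)    = refl
    zeros₀ a -[1+ i ] = refl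

    K : ℕ
    K = N * suc M

    X≤ : ∀ i j → ∣ X i j ∣ ≤ K
    X≤ i j = ∣sum∣≤ N _ (suc M) λ k _ → begin
      ∣ values g (i * N + k) ℤ.* χ (s₀ 3) p (n / 2) k j ∣      ≡⟨ ℤ.∣i*j∣≡∣i∣*∣j∣ (values g (i * N + k)) _ ⟩
      ∣ values g (i * N + k) ∣ * ∣ χ (s₀ 3) p (n / 2) k j ∣    ≤⟨ *-mono-≤ (values≤ g g≤ (i * N + k)) (∣χ∣≤1 (s₀ 3) p (n / 2) k j) ⟩
      suc M * 1                                                ≡⟨ *-identityʳ (suc M) ⟩
      suc M                                                    ∎
      where open ≤-Reasoning

    Y≤ : ∀ i j → ∣ Y i j ∣ ≤ K
    Y≤ i j = ∣sum∣≤ N _ (suc M) λ k _ → begin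
      ∣ χ (s₀ 3) (n / 2) 0 i k ℤ.* values h (k * N + j) ∣      ≡⟨ ℤ.∣i*j∣≡∣i∣*∣j∣ (χ (s₀ 3) (n / 2) 0 i k) _ ⟩
      ∣ χ (s₀ 3) (n / 2) 0 i k ∣ * ∣ values h (k * N + j) ∣    ≤⟨ *-mono-≤ (∣χ∣≤1 (s₀ 3) (n / 2) 0 i k) (values≤ h h≤ (k * N + j)) ⟩
      1 * suc M                                                ≡⟨ *-identityˡ (suc M) ⟩
      suc M                                                    ∎
      where open ≤-Reasoning

    N≤E : N ≤ E
    N≤E = ≤-trans (m≤m*n N N) N²≤E

    K≤V : K ≤ V
    K≤V = ≤-trans (*-monoˡ-≤ (suc M) N≤E) W≤V

    N²K²≤V : N * N * (K * K) ≤ V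
    N²K²≤V = ≤-trans (≤-reflexive (regroup N (suc M))) (*-mono-≤ (*-monoˡ-≤ (suc M) N²≤E) (*-monoˡ-≤ (suc M) N²≤E))
      where
      regroup : ∀ a b → a * a * (a * b * (a * b)) ≡ a * a * b * (a * a * b)
      regroup = solve-∀

    execution = query-run {s₀} {program} small₀ refl (λ _ → refl) (λ _ → refl) (λ _ → refl) zeros₀
      (computes N A₁ B₁ (suc M) (λ i j → values≤ g g≤ (toℕ i * N + toℕ j)) (λ i j → χ≤ p (n / 2) (toℕ i) (toℕ j)))
      (computes N A₂ B₂ (suc M) (λ i j → χ≤ (n / 2) 0 (toℕ i) (toℕ j)) (λ i j → values≤ h h≤ (toℕ i * N + toℕ j)))
      X≤ Y≤ K≤V N²K²≤V

    correct : sum N (λ i → sum N (λ j → X i j ℤ.* Y i j)) ≡ (g ⊛ h) v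
    correct = ⊛-matrices (s₀ 3) q+p≡n g h v (m≤m+n (n / 2) (n % 2)) (codes (s₀ 3) 0 v (λ _ → refl))

    1≤βμ : 1 ≤ β * μ
    1≤βμ = *-mono-≤ (1≤bits (d ^ n)) (1≤bits M)

    scale : ∀ a → a ≤ a * (β * μ)
    scale a = ≤-trans (≤-reflexive (sym (*-identityʳ a))) (*-monoʳ-≤ a 1≤βμ)

    -- Lengths add up, but the final bound is a product; as `β` and `μ` are at least 1, each summand
    -- is at most a constant times β μ.
    L≤ : L ≤ 2 * (bits d + 3) * (β * μ)
    L≤ = begin
      bits (W * W)                                ≤⟨ bits-* W W ⟩
      bits W + bits W                             ≡⟨ cong (λ z → bits W + z) (+-identityʳ (bits W)) ⟨
      2 * bits W                                  ≤⟨ *-monoʳ-≤ 2 W-bits ⟩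
      2 * ((bits d + 3) * (β * μ))                ≡⟨ *-assoc 2 (bits d + 3) (β * μ) ⟨
      2 * (bits d + 3) * (β * μ)                  ∎
      where
      open ≤-Reasoning
      W-bits : bits W ≤ (bits d + 3) * (β * μ)
      W-bits = begin
        bits W                           ≤⟨ bits-* E (suc M) ⟩
        bits E + bits (suc M)            ≤⟨ +-mono-≤ (bits-* d (d ^ n)) (bits-suc M) ⟩
        bits d + β + (1 + μ)             ≡⟨ +-assoc (bits d) β (1 + μ) ⟩
        bits d + (β + (1 + μ))           ≤⟨ +-*-≤ (bits d) 3 (scale (bits d)) (+-*-≤ 1 2
                                              (≤-trans (m≤m*n β μ) (≤-reflexive (sym (*-identityˡ (β * μ)))))
                                              (+-*-≤ 1 1 (scale 1) (≤-trans (m≤n*m μ β) (≤-reflexive (sym (*-identityˡ (β * μ))))))) ⟩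
        (bits d + 3) * (β * μ)           ∎

    β²μ≤ : β * (β * μ) ≤ β ^ (2 + k) * μ ^ (2 + k)
    β²μ≤ = begin
      β * (β * μ)                         ≡⟨ *-assoc β β μ ⟨
      β * β * μ                           ≡⟨ cong₂ (λ x y → β * x * y) (sym (*-identityʳ β)) (sym (*-identityʳ μ)) ⟩
      β ^ 2 * μ ^ 1                       ≤⟨ *-mono-≤ (^-monoʳ-≤ β (m≤m+n 2 k)) (^-monoʳ-≤ μ {1} {2 + k} (s≤s z≤n)) ⟩
      β ^ (2 + k) * μ ^ (2 + k)           ∎
      where open ≤-Reasoning

    own≤ : ownTime ≤ K₀ · N ^⟨ ω · 1 / 1 ⟩
    own≤ = ≤·-mono ω {K = K₀} {K′ = ownFactor * (2 * (bits d + 3)) * (β * (β * μ))} {b = N} (begin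
      ownTime                                                              ≤⟨ ownTime≤ β (≤bits-^ d n 2≤d) ⟩
      ownFactor * (β * L * (N * N))                                        ≤⟨ *-monoʳ-≤ ownFactor (*-monoˡ-≤ (N * N) (*-monoʳ-≤ β L≤)) ⟩
      ownFactor * (β * (2 * (bits d + 3) * (β * μ)) * (N * N))             ≡⟨ regroup ownFactor β (2 * (bits d + 3)) (β * μ) (N * N) ⟩
      ownFactor * (2 * (bits d + 3)) * (β * (β * μ)) * (N * N)             ∎)
      (*-mono-≤ (m≤m+n (ownFactor * (2 * (bits d + 3))) _) β²μ≤)
      (≤·-square ω {b = N} 2≤ω)
      where
      open ≤-Reasoning
      regroup : ∀ a b c e z → a * (b * (c * e) * z) ≡ a * c * (b * e) * z
      regroup = solve-∀

    K₁ : ℕ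
    K₁ = C * bits N ^ k * bits (suc M) ^ k

    product≤ : K₁ ≤ K₀
    product≤ = begin
      C * bits N ^ k * bits (suc M) ^ k                            ≤⟨ *-mono-≤ (*-monoʳ-≤ C (^-monoˡ-≤ k N-bits)) (^-monoˡ-≤ k M-bits) ⟩
      C * ((bits d + 1) * β) ^ k * (2 * μ) ^ k                     ≡⟨ cong₂ (λ x y → C * x * y) (^-distribʳ-* (bits d + 1) β k) (^-distribʳ-* 2 μ k) ⟩
      C * ((bits d + 1) ^ k * β ^ k) * (2 ^ k * μ ^ k)             ≡⟨ regroup C ((bits d + 1) ^ k) (β ^ k) (2 ^ k) (μ ^ k) ⟩
      C * ((bits d + 1) ^ k * 2 ^ k) * (β ^ k * μ ^ k)             ≤⟨ *-mono-≤ (m≤n+m _ (ownFactor * (2 * (bits d + 3))))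
                                                                        (*-mono-≤ (^-monoʳ-≤ β (m≤n+m k 2)) (^-monoʳ-≤ μ (m≤n+m k 2))) ⟩
      K₀                                                           ∎
      where
      open ≤-Reasoning
      regroup : ∀ c a b e m → c * (a * b) * (e * m) ≡ c * (a * e) * (b * m)
      regroup = solve-∀
      N-bits : bits N ≤ (bits d + 1) * β
      N-bits = ≤-trans (bits-mono N≤E) (≤-trans (bits-* d (d ^ n))
        (+-*-≤ (bits d) 1 (m≤m*n (bits d) β) (≤-reflexive (sym (*-identityˡ β)))))
      M-bits : bits (suc M) ≤ 2 * μ
      M-bits = ≤-trans (bits-suc M) (+-mono-≤ (1≤bits M) (≤-reflexive (sym (+-identityʳ μ))))

    -- Each factor 2 stems from one use of `≤·-+`, adding the first product to the own time and then
    -- the second; `d ^ p₀` pays for rounding n / 2 up.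
    solution : Computes (query program) (input g h v) ((g ⊛ h) v ∷ [])
      (λ t → t ≤ 2 * (2 * factor) * d ^ p₀ * β ^ (2 + k) * μ ^ (2 + k) · d ^⟨ ω · n / 2 ⟩)
    solution =
      let t₁ , t₂ , t₁≤ , t₂≤ , s′ , t , run , t≤ , answer = execution
          _ , q₀ , q₀≢0 , u = upper-fraction ω 2≤ω
      in s′ , t , run , (λ { zero → trans answer correct }) ,
      ≤·-mono ω {K′ = 2 * (2 * K₀) * d ^ p₀} {b = d} {n} {2} t≤
        (≤-reflexive (regroup factor (d ^ p₀) (β ^ (2 + k)) (μ ^ (2 + k))))
        (≤·-half ω {N = N} {d} {n} p₀ q₀ {{q₀≢0}} u N²≤E
          (≤·-+ ω {ownTime + t₁} {t₂} {2 * K₀} {N} {1} {1} (≤·-+ ω {ownTime} {t₁} {K₀} {N} {1} {1} own≤ (≤·-mono ω {t₁} {K′ = K₁} {N} {1} {1} ≤-refl product≤ t₁≤))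
            (≤·-mono ω {t₂} {K′ = K₁} {N} {1} {1} ≤-refl (≤-trans product≤ (m≤m+n K₀ (K₀ + 0))) t₂≤)))
      where
      regroup : ∀ a e b m → 2 * (2 * (a * (b * m))) * e ≡ 2 * (2 * a) * e * b * m
      regroup = solve-∀

  solvable : Σ[ P ∈ Cmd ] Σ[ C ∈ ℕ ] Σ[ k ∈ ℕ ] SolvesQueryIn ω P C k
  solvable = query program , 2 * (2 * factor) * d ^ p₀ , 2 + k , solution

theorem1p4 : (ω : ℝ) → IsMatMulExponent ω →
    (D : Set) (d : ℕ) (enum : D ↔ Fin d) (f : D → D → D) →
    Σ[ P ∈ Cmd ] Σ[ C ∈ ℕ ] Σ[ k ∈ ℕ ] FQuery.SolvesQueryIn enum f ω P C k
theorem1p4 ω multiplication D zero          enum f = Trivial.solvable z≤n enum f ω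
theorem1p4 ω multiplication D (suc zero)    enum f = Trivial.solvable (s≤s z≤n) enum f ω
theorem1p4 ω multiplication D (suc (suc d)) enum f = Reduction.solvable multiplication (s≤s (s≤s z≤n)) enum f
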